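{- For $|q|<1$, $$\mathrm{C}\Phi_4(q)=\frac{1}{(q;q)_\infty^4}\Big(\Theta_3^3(q^2)+3\Theta_3(q^2)\Theta_2^2(q^2)\Big)=\frac{\Theta_3^4(q)}{(q;q)_\infty^4\Theta_3(q^2)}+\frac{\Theta_3^2(-q)\Theta_2^2(q^2)}{(q;q)_\infty^4\Theta_3(q^2)}.$$
   Context: A $k$-colored generalized Frobenius symbol is a two-row array with $d\ge 0$ columns whose entries are colored nonnegative integers $\ell_c$ ($\ell\ge 0$, color $c\in\{1,\dots,k\}$), each row strictly decreasing with respect to the total order $0_1\prec 0_2\prec\cdots\prec 0_k\prec 1_1\prec\cdots\prec 1_k\prec 2_1\prec\cdots$. It is a $k$-colored generalized Frobenius partition of $n=d+\sum(\text{integer values of all entries})$. $c\phi_k(n)$ is the number of such partitions of $n$ (with $c\phi_k(0)=1$), and $\mathrm{C}\Phi_k(q)=\sum_{n\ge0}c\phi_k(n)q^n$. $(a;q)_\infty=\prod_{j\ge1}(1-aq^{j-1})$, $\Theta_3(x)=\sum_{j\in\mathbf Z}x^{j^2}$ and $\Theta_2(x)=\sum_{j\in\mathbf Z}x^{(j+1/2)^2}$. -}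

module Defs where

open import Data.Nat as ℕ using (ℕ; zero; suc)
open import Data.Integer as ℤ using (ℤ; +_; -_)
open import Data.Fin as Fin using (Fin)
open import Data.Product using (_×_; _,_; proj₁)
open import Data.Sum using (_⊎_)
open import Data.List using (List; []; _∷_; length; map)
open import Data.Nat.ListAction using (sum)
open import Data.List.Relation.Unary.Linked using (Linked)
open import Data.Bool using (if_then_else_)
open import Relation.Binary.PropositionalEquality using (_≡_)
open import Relation.Nullary using (does)

-- A colored nonnegative integer ℓ_c is a pair (ℓ , c), c : Fin k
-- (Fin k = colors 1..k, listed as 0..k-1).
Colored : ℕ → Set
Colored k = ℕ × Fin k

_≺_ : {k : ℕ} → Colored k → Colored k → Set
(a , c) ≺ (b , c') = (a ℕ.< b) ⊎ ((a ≡ b) × (c Fin.< c'))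

_≻_ : {k : ℕ} → Colored k → Colored k → Set
x ≻ y = y ≺ x

value-sum : {k : ℕ} → List (Colored k) → ℕ
value-sum xs = sum (map proj₁ xs)

record GFP (k n : ℕ) : Set where
  field
    top    : List (Colored k)
    bottom : List (Colored k)
    sameLength : length top ≡ length bottom
    topDecreasing    : Linked _≻_ top
    bottomDecreasing : Linked _≻_ bottom
    weight : length top ℕ.+ value-sum top ℕ.+ value-sum bottom ≡ n

-- Formal power series in q with integer coefficients: n ↦ [q^n]

PS : Set
PS = ℕ → ℤ

sumTo : ℕ → (ℕ → ℤ) → ℤ
sumTo zero f = f 0
sumTo (suc n) f = sumTo n f ℤ.+ f (suc n)

oneS : PS
oneS zero = + 1
oneS (suc n) = + 0

monoS : ℕ → PS
monoS k n = if does (k ℕ.≟ n) then + 1 else + 0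

_⊕_ : PS → PS → PS
(f ⊕ g) n = f n ℤ.+ g n

_⊖_ : PS → PS → PS
(f ⊖ g) n = f n ℤ.- g n

scaleS : ℤ → PS → PS
scaleS c f n = c ℤ.* f n

_⊛_ : PS → PS → PS
(f ⊛ g) n = sumTo n (λ i → f i ℤ.* g (n ℕ.∸ i))

powS : PS → ℕ → PS
powS f zero = oneS
powS f (suc m) = f ⊛ powS f m

atSquare : PS → PS
atSquare f n = if does ((n ℕ.% 2) ℕ.≟ 0) then f (n ℕ./ 2) else + 0

atNeg : PS → PS
atNeg f n = if does ((n ℕ.% 2) ℕ.≟ 0) then f n else - f n

timesQ : PS → PS
timesQ f zero = + 0
timesQ f (suc n) = f n

-- Reciprocal of a series with constant term 1
-- (g_0 = 1, g_m = - Σ_{i=1}^{m} f_i g_{m-i}).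
private
  nth : List ℤ → ℕ → ℤ
  nth [] _ = + 0
  nth (x ∷ xs) zero = x
  nth (x ∷ xs) (suc i) = nth xs i

  -- invRev f n = [g_n , g_{n-1} , … , g_0]
  invRev : PS → ℕ → List ℤ
  invRev f zero = + 1 ∷ []
  invRev f (suc n) =
    (- sumTo n (λ i → f (suc i) ℤ.* nth (invRev f n) i)) ∷ invRev f n

invS : PS → PS
invS f n = nth (invRev f n) 0

-- (q;q)_∞ : coefficient of q^n equals that of ∏_{j=1}^{n} (1 - q^j)
eulerTrunc : ℕ → PS
eulerTrunc zero = oneS
eulerTrunc (suc m) = eulerTrunc m ⊛ (oneS ⊖ monoS (suc m))

qPoch : PS
qPoch n = eulerTrunc n n

-- Θ_3(q) = Σ_{j∈ℤ} q^{j²};  [q^n] = #{ j ∈ ℤ : j² = n }, and such j has |j| ≤ n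
indicator : ℤ → ℤ → ℤ
indicator a b = if does (a ℤ.≟ b) then + 1 else + 0

theta3 : PS
theta3 n = sumTo (2 ℕ.* n) (λ i → let j = + i ℤ.- + n in indicator (j ℤ.* j) (+ n))

-- T(q) = Σ_{j∈ℤ} q^{j(j+1)}, so Θ_2(x) = x^{1/4} T(x);  solutions have -n-1 ≤ j ≤ n
thetaT : PS
thetaT n = sumTo (2 ℕ.* n ℕ.+ 1)
  (λ i → let j = + i ℤ.- + suc n in indicator (j ℤ.* (j ℤ.+ + 1)) (+ n))

-- Θ_2²(q²) = (q^{1/2} T(q²))² = q · T(q²)²
theta2sq-q2 : PS
theta2sq-q2 = timesQ (atSquare (thetaT ⊛ thetaT))

{-# OPTIONS --safe #-}

-- The colours are independent, so CΦ₄(q) is the constant term in z of the fourth power of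
-- ∏_{j≥1} (1 + z qʲ) (1 + z⁻¹ qʲ⁻¹), which by the Jacobi triple product is (q;q)_∞⁻⁴ times
-- Σ q^{(m₁² + m₂² + m₃² + m₄²)/2} over m ∈ ℤ⁴ with m₁ + m₂ + m₃ + m₄ = 0.  The substitution
-- (a , b , c) = (m₁ + m₂ , m₁ + m₃ , m₁ + m₄) turns this lattice into the triples with even sum
-- and preserves the norm; separating the triples with no odd entry from those with two gives
-- Θ₃³(q²) + 3 Θ₃(q²) Θ₂²(q²).  The second formula then follows from
-- Θ₃²(±q) = Θ₃²(q²) ± Θ₂²(q²), the parity splitting of ℤ².
--
-- The coefficient of qⁿ only sees q modulo qⁿ⁺¹.  In ℤ[q]/(qⁿ⁺¹) the triple product follows from
-- its finite q-binomial form, because there (q;q)_∞ = (q;q)_n is inverse to every q-binomial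
-- coefficient that is not multiplied by a vanishing power of q.

module Submission where

open import Defs
open import Algebra.Bundles using (CommutativeRing)
import Algebra.Properties.Ring as RingProperties
import Algebra.Properties.Semiring.Exp as Exp
import Algebra.Solver.Ring.NaturalCoefficients.Default as NatSolver
open import Data.Bool using (true; false; if_then_else_)
open import Data.Empty using (⊥; ⊥-elim)
open import Data.Fin as Fin using (Fin)
open import Data.Fin.Permutation using (↔⇒≡)
open import Data.Fin.Properties using (+↔⊎; *↔×)
open import Data.Integer as ℤ using (ℤ; +_; -[1+_])
import Data.Integer.DivMod as ℤ
import Data.Integer.Properties as ℤ
import Data.Integer.Tactic.RingSolver as ℤ-Solver
open import Data.List using (List; []; _∷_; _++_; map; filter; length; cartesianProduct; upTo; applyUpTo; lookup)
open import Data.List.Membership.Propositional using (_∈_)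
open import Data.List.Membership.Propositional.Properties using
  ( ∈-lookup; ∈-applyUpTo⁺; ∈-upTo⁺; ∈-filter⁺; ∈-filter⁻; ∈-cartesianProduct⁺; ∈-cartesianProduct⁻
  ; ∈-map⁺; ∈-map⁻; ∈-++⁺ˡ; ∈-++⁺ʳ )
open import Data.List.Membership.Propositional.Properties.WithK using (unique⇒irrelevant)
open import Data.List.Relation.Unary.All as All using (All; []; _∷_)
import Data.List.Relation.Unary.All.Properties as All
open import Data.List.Relation.Unary.AllPairs as AllPairs using (AllPairs; []; _∷_)
open import Data.List.Relation.Unary.Any using (here; there; index)
open import Data.List.Relation.Unary.Any.Properties using (lookup-index)
open import Data.List.Relation.Unary.Linked as Linked using (Linked)
open import Data.List.Relation.Unary.Linked.Properties using (AllPairs⇒Linked; Linked⇒AllPairs)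
open import Data.List.Relation.Unary.Unique.Propositional using (Unique)
import Data.List.Relation.Unary.Unique.Propositional.Properties as Unique
open import Data.Nat as ℕ using (ℕ; zero; suc; z≤n; s≤s)
import Data.Nat.DivMod as ℕ
import Data.Nat.Properties as ℕ
open import Data.Product using (Σ; Σ-syntax; _×_; _,_; proj₁; proj₂)
open import Data.Product.Function.NonDependent.Propositional using (_×-↔_)
open import Data.Sum using (_⊎_; inj₁; inj₂)
open import Data.Sum.Function.Propositional using (_⊎-↔_)
open import Function using (_∘_; id)
open import Function.Bundles using (_↔_; mk↔ₛ′)
open import Function.Properties.Inverse using (↔-sym; ↔-trans)
open import Level using (0ℓ)
open import Relation.Binary.PropositionalEquality as ≡ using (_≡_; _≢_; cong; cong₂; subst)
open import Relation.Binary.PropositionalEquality.WithK using (≡-irrelevant)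
import Relation.Binary.Reasoning.Setoid as SetoidReasoning
open import Relation.Nullary using (¬_; Dec; yes; no; does)

-- One construction, `Series`, serves both variables: ℤ[q]/(qⁿ⁺¹) is a truncated series ring over ℤ,
-- and the series in z, cut off at degree K, form a truncated series ring over that. The finite
-- triple product holds over any commutative ring with a chosen element q; only its limiting form
-- asks for qⁿ⁺¹ = 0. Negative powers of z never occur: each factor containing z⁻¹ is multiplied by
-- z, which moves the constant term of the fourth power to degree 4N for a window size N. At both
-- ends of the argument stand cardinalities. Extracting a coefficient from a sum of monomials is
-- filtering a list, so Frobenius partitions and lattice vectors are both enumerated by
-- duplicate-free lists. The theta series are given by finite sums of indicators, hence the lattice
-- identities are obtained from weight-preserving bijections between fibres, and ring algebra is
-- left only for clearing denominators and for passing between the two formulas.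

-- Commutative rings and truncated power series.

Ring : Set₁
Ring = CommutativeRing 0ℓ 0ℓ

module RingKit (R : Ring) where
  open CommutativeRing R public hiding (zero)
  open Exp semiring public using (_^_; ^-homo-*; ^-congʳ; ^-congˡ)
  open RingProperties ring public
  open SetoidReasoning setoid public
  open NatSolver commutativeSemiring public using (solve; _:+_; _:*_; _:=_; con)

  infixl 8 _⁴
  _⁴ : Carrier → Carrier
  x ⁴ = x * (x * (x * x))

  ⁴-cong : ∀ {x y} → x ≈ y → x ⁴ ≈ y ⁴
  ⁴-cong e = *-cong e (*-cong e (*-cong e e))

  1^ : ∀ n → 1# ^ n ≈ 1#
  1^ zero    = refl
  1^ (suc n) = trans (*-identityˡ _) (1^ n)

  *-^-distrib : ∀ x y n → (x * y) ^ n ≈ x ^ n * y ^ n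
  *-^-distrib x y zero    = sym (*-identityˡ 1#)
  *-^-distrib x y (suc n) = trans (*-congˡ (*-^-distrib x y n)) 
    (solve 4 (λ a b c d → a :* b :* (c :* d) := a :* c :* (b :* d)) refl x y (x ^ n) (y ^ n))

-- Power series over R; two series are identified when they agree up to index K.
module Series (R : Ring) (K : ℕ) where
  open RingKit R

  infixl 7 _·_
  -- Recursion on the index, with `f` split as its constant term plus z times `f ∘ suc`, lets the
  -- ring laws go by induction without reindexing finite sums; `⊛-·` identifies it with the
  -- convolution of the statement.
  _·_ : (ℕ → Carrier) → (ℕ → Carrier) → ℕ → Carrier
  (f · g) zero    = f 0 * g 0
  (f · g) (suc n) = f 0 * g (suc n) + ((f ∘ suc) · g) n

  const : Carrier → ℕ → Carrier
  const c zero    = c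
  const c (suc _) = 0#

  X : ℕ → Carrier
  X zero          = 0#
  X (suc zero)    = 1#
  X (suc (suc _)) = 0#

  shift : (ℕ → Carrier) → ℕ → Carrier
  shift f zero    = 0#
  shift f (suc n) = f n

  -- A product coefficient reads only indices up to its own; hence multiplication respects the
  -- truncated equality.
  ·-cong≤ : ∀ n {f f′ g g′} → (∀ i → i ℕ.≤ n → f i ≈ f′ i) → (∀ i → i ℕ.≤ n → g i ≈ g′ i) →
            (f · g) n ≈ (f′ · g′) n
  ·-cong≤ zero    e e′ = *-cong (e 0 z≤n) (e′ 0 z≤n)
  ·-cong≤ (suc n) e e′ = +-cong (*-cong (e 0 z≤n) (e′ (suc n) ℕ.≤-refl))
    (·-cong≤ n (λ i i≤n → e (suc i) (s≤s i≤n)) (λ i i≤n → e′ i (ℕ.m≤n⇒m≤1+n i≤n)))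

  ·-zeroˡ : ∀ g n → ((λ _ → 0#) · g) n ≈ 0#
  ·-zeroˡ g zero    = zeroˡ (g 0)
  ·-zeroˡ g (suc n) = trans (+-cong (zeroˡ _) (·-zeroˡ g n)) (+-identityˡ 0#)

  const-· : ∀ c g n → (const c · g) n ≈ c * g n
  const-· c g zero    = refl
  const-· c g (suc n) = trans (+-congˡ (·-zeroˡ g n)) (+-identityʳ _)

  -- Splits off the summand at the opposite end from the definition; commutativity compares the two.
  ·-step : ∀ f g n → (f · g) (suc n) ≈ (f · (g ∘ suc)) n + f (suc n) * g 0
  ·-step f g zero    = refl
  ·-step f g (suc n) = trans (+-congˡ (·-step (f ∘ suc) g n)) (sym (+-assoc _ _ _))

  ·-comm : ∀ f g n → (f · g) n ≈ (g · f) n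
  ·-comm f g zero    = *-comm (f 0) (g 0)
  ·-comm f g (suc n) = begin
    f 0 * g (suc n) + ((f ∘ suc) · g) n  ≈⟨ +-cong (*-comm _ _) (·-comm (f ∘ suc) g n) ⟩
    g (suc n) * f 0 + (g · (f ∘ suc)) n  ≈⟨ +-comm _ _ ⟩
    (g · (f ∘ suc)) n + g (suc n) * f 0  ≈⟨ ·-step g f n ⟨
    (g · f) (suc n)                      ∎

  ·-distribʳ : ∀ f g h n → ((λ i → g i + h i) · f) n ≈ (g · f) n + (h · f) n
  ·-distribʳ f g h zero    = distribʳ (f 0) (g 0) (h 0)
  ·-distribʳ f g h (suc n) = trans (+-congˡ (·-distribʳ f (g ∘ suc) (h ∘ suc) n))
    (solve 5 (λ a b c d e → (a :+ b) :* c :+ (d :+ e) := a :* c :+ d :+ (b :* c :+ e)) refl (g 0) (h 0) (f (suc n)) _ _)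

  ·-scaleˡ : ∀ c f g n → ((λ i → c * f i) · g) n ≈ c * (f · g) n
  ·-scaleˡ c f g zero    = *-assoc c (f 0) (g 0)
  ·-scaleˡ c f g (suc n) = trans (+-congˡ (·-scaleˡ c (f ∘ suc) g n)) 
    (solve 4 (λ a b c d → a :* b :* c :+ a :* d := a :* (b :* c :+ d)) refl c (f 0) (g (suc n)) _)

  ·-assoc : ∀ f g h n → ((f · g) · h) n ≈ (f · (g · h)) n
  ·-assoc f g h zero    = *-assoc (f 0) (g 0) (h 0)
  ·-assoc f g h (suc n) = begin
    f 0 * g 0 * h (suc n) + ((λ i → f 0 * g (suc i) + ((f ∘ suc) · g) i) · h) n
      ≈⟨ +-congˡ (·-distribʳ h (λ i → f 0 * g (suc i)) ((f ∘ suc) · g) n) ⟩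
    f 0 * g 0 * h (suc n) + (((λ i → f 0 * g (suc i)) · h) n + (((f ∘ suc) · g) · h) n)
      ≈⟨ +-congˡ (+-cong (·-scaleˡ (f 0) (g ∘ suc) h n) (·-assoc (f ∘ suc) g h n)) ⟩
    f 0 * g 0 * h (suc n) + (f 0 * ((g ∘ suc) · h) n + ((f ∘ suc) · (g · h)) n)
      ≈⟨ solve 5 (λ a b c d e → a :* b :* c :+ (a :* d :+ e) := a :* (b :* c :+ d) :+ e) refl (f 0) (g 0) (h (suc n)) _ _ ⟩
    f 0 * (g 0 * h (suc n) + ((g ∘ suc) · h) n) + ((f ∘ suc) · (g · h)) n  ∎

  ·-identityˡ : ∀ g n → (const 1# · g) n ≈ g n
  ·-identityˡ g n = trans (const-· 1# g n) (*-identityˡ (g n))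

  series : Ring
  series = record
    { Carrier = ℕ → Carrier
    ; _≈_ = λ f g → ∀ i → i ℕ.≤ K → f i ≈ g i
    ; _+_ = λ f g i → f i + g i
    ; _*_ = _·_
    ; -_ = λ f i → - f i
    ; 0# = λ _ → 0#
    ; 1# = const 1#
    ; isCommutativeRing = record
      { isRing = record
        { +-isAbelianGroup = record
          { isGroup = record
            { isMonoid = record
              { isSemigroup = record
                { isMagma = record
                  { isEquivalence = record
                    { refl  = λ _ _ → refl
                    ; sym   = λ e i le → sym (e i le)
                    ; trans = λ e e′ i le → trans (e i le) (e′ i le) }
                  ; ∙-cong = λ e e′ i le → +-cong (e i le) (e′ i le) }
                ; assoc = λ f g h i _ → +-assoc (f i) (g i) (h i) }
              ; identity = (λ f i _ → +-identityˡ (f i)) , (λ f i _ → +-identityʳ (f i)) }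
            ; inverse = (λ f i _ → -‿inverseˡ (f i)) , (λ f i _ → -‿inverseʳ (f i))
            ; ⁻¹-cong = λ e i le → -‿cong (e i le) }
          ; comm = λ f g i _ → +-comm (f i) (g i) }
        ; *-cong = λ e e′ i le → ·-cong≤ i (λ j j≤i → e j (ℕ.≤-trans j≤i le)) (λ j j≤i → e′ j (ℕ.≤-trans j≤i le))
        ; *-assoc = λ f g h i _ → ·-assoc f g h i
        ; *-identity = (λ g i _ → ·-identityˡ g i)
                     , (λ g i _ → trans (·-comm g (const 1#) i) (·-identityˡ g i))
        ; distrib = (λ f g h i _ → trans (·-comm f _ i) (trans (·-distribʳ f g h i) (+-cong (·-comm g f i) (·-comm h f i))))
                  , (λ f g h i _ → ·-distribʳ f g h i) }
      ; *-comm = λ f g i _ → ·-comm f g i } }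

  private module S = RingKit series

  X-· : ∀ f n → (X · f) n ≈ shift f n
  X-· f zero    = zeroˡ (f 0)
  X-· f (suc n) = begin
    0# * f (suc n) + ((X ∘ suc) · f) n  ≈⟨ +-cong (zeroˡ _) (·-cong≤ n {f′ = const 1#} {g′ = f} (λ { zero _ → refl ; (suc i) _ → refl }) (λ _ _ → refl)) ⟩
    0# + (const 1# · f) n               ≈⟨ +-identityˡ _ ⟩
    (const 1# · f) n                    ≈⟨ ·-identityˡ f n ⟩
    f n                                 ∎

  const-* : ∀ a b → const (a * b) S.≈ const a · const b
  const-* a b i _ = sym (trans (const-· a (const b) i) (lemma i))
    where
    lemma : ∀ i → a * const b i ≈ const (a * b) i
    lemma zero    = refl
    lemma (suc i) = zeroʳ a

  const-cong : ∀ {a b} → a ≈ b → const a S.≈ const b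
  const-cong e zero    _ = e
  const-cong e (suc i) _ = refl

  const-^ : ∀ a n → const (a ^ n) S.≈ const a S.^ n
  const-^ a zero    = S.refl {const 1#}
  const-^ a (suc n) = S.trans (const-* a (a ^ n)) (S.*-congˡ {const a} (const-^ a n))

  -- The result is phrased with `does` so that it agrees with `monoS` and with the test made by
  -- `filter`.
  X^-const : ∀ a c i → (X S.^ a · const c) i ≈ (if does (a ℕ.≟ i) then c else 0#)
  X^-const zero    c zero    = ·-identityˡ (const c) 0
  X^-const zero    c (suc i) = ·-identityˡ (const c) (suc i)
  X^-const (suc a) c zero    = trans (·-assoc X (X S.^ a) (const c) 0) (X-· (X S.^ a · const c) 0)
  X^-const (suc a) c (suc i) = trans (·-assoc X (X S.^ a) (const c) (suc i)) (trans (X-· _ (suc i)) (X^-const a c i))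

-- The finite Jacobi triple product

triangle : ℕ → ℕ
triangle zero    = 0
triangle (suc n) = suc n ℕ.+ triangle n

-- m (m + 1) / 2 at the integer m = k − b
tri : ℕ → ℕ → ℕ
tri k       zero    = triangle k
tri zero    (suc b) = triangle b
tri (suc k) (suc b) = tri k b

-- With T(m) = m (m + 1) / 2 this is T(m) - T(m - 1) = m at m = k - b, freed of subtraction.
tri-suc : ∀ k b → b ℕ.+ tri k b ≡ k ℕ.+ tri k (suc b)
tri-suc zero    zero    = ≡.refl
tri-suc zero    (suc b) = ≡.refl
tri-suc (suc k) zero    = ≡.refl
tri-suc (suc k) (suc b) = cong suc (tri-suc k b)

n≤triangle : ∀ n → n ℕ.≤ triangle n
n≤triangle zero    = z≤n
n≤triangle (suc n) = ℕ.m≤m+n (suc n) (triangle n)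

tri-+ : ∀ b d → tri (b ℕ.+ d) b ≡ triangle d
tri-+ zero    d = ≡.refl
tri-+ (suc b) d = tri-+ b d

-- The symmetry of T under m ↦ -1 - m, here at m = -1 - d.
tri-+-suc : ∀ k d → tri k (suc (k ℕ.+ d)) ≡ triangle d
tri-+-suc zero    d = ≡.refl
tri-+-suc (suc k) d = tri-+-suc k d

-- Gaussian binomials and their inverses for nilpotent q.

module QBinomial (R : Ring) (q : CommutativeRing.Carrier R) where
  open RingKit R

  -- The Gaussian binomial coefficient, given by a Pascal rule because q-factorials cannot be
  -- divided in a general ring.
  qbin : ℕ → ℕ → Carrier
  qbin _       zero    = 1#
  qbin zero    (suc k) = 0#
  qbin (suc n) (suc k) = qbin n k + q ^ suc k * qbin n (suc k)

  -- The product (q;q)_n, not normalised by powers of 1 - q.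
  qfac : ℕ → Carrier
  qfac zero    = 1#
  qfac (suc n) = qfac n * (1# - q ^ suc n)

  qbin-> : ∀ n k → n ℕ.< k → qbin n k ≈ 0#
  qbin-> zero    (suc k) _         = refl
  qbin-> (suc n) (suc k) (s≤s n<k) = begin
    qbin n k + q ^ suc k * qbin n (suc k)  ≈⟨ +-cong (qbin-> n k n<k) (*-congˡ (qbin-> n (suc k) (ℕ.m≤n⇒m≤1+n n<k))) ⟩
    0# + q ^ suc k * 0#                    ≈⟨ trans (+-identityˡ _) (zeroʳ _) ⟩
    0#                                     ∎

  1-q^-split : ∀ a b → (1# - q ^ a) + q ^ a * (1# - q ^ b) ≈ 1# - q ^ (a ℕ.+ b)
  1-q^-split a b = begin
    (1# - q ^ a) + q ^ a * (1# - q ^ b)               ≈⟨ +-congˡ (trans (distribˡ _ _ _) (+-cong (*-identityʳ _) (sym (-‿distribʳ-* _ _)))) ⟩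
    (1# - q ^ a) + (q ^ a - q ^ a * q ^ b)            ≈⟨ solve 4 (λ o a a′ c → (o :+ a′) :+ (a :+ c) := (o :+ c) :+ (a′ :+ a)) refl 1# (q ^ a) (- (q ^ a)) (- (q ^ a * q ^ b)) ⟩
    (1# - q ^ a * q ^ b) + (- (q ^ a) + q ^ a)        ≈⟨ trans (+-congˡ (-‿inverseˡ _)) (+-identityʳ _) ⟩
    1# - q ^ a * q ^ b                                ≈⟨ +-congˡ (-‿cong (^-homo-* q a b)) ⟨
    1# - q ^ (a ℕ.+ b)                                ∎

  -- In the Pascal rule the two terms contribute (q;q) of the previous index times 1 - q^(k+1) and
  -- q^(k+1) (1 - q^(l+1)); `1-q^-split` adds these up to the missing last factor.
  qbin-qfac : ∀ k l → qbin (k ℕ.+ l) k * (qfac k * qfac l) ≈ qfac (k ℕ.+ l)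
  qbin-qfac zero    l = trans (*-identityˡ _) (*-identityˡ _)
  qbin-qfac (suc k) zero = begin
    (qbin (k ℕ.+ 0) k + q ^ suc k * qbin (k ℕ.+ 0) (suc k)) * (qfac k * u * 1#)
      ≈⟨ *-congʳ (trans (+-congˡ (trans (*-congˡ (qbin-> (k ℕ.+ 0) (suc k) (ℕ.≤-reflexive (cong suc (ℕ.+-identityʳ k))))) (zeroʳ _))) (+-identityʳ _)) ⟩
    qbin (k ℕ.+ 0) k * (qfac k * u * 1#)
      ≈⟨ solve 4 (λ b f u o → b :* (f :* u :* o) := b :* (f :* o) :* u) refl _ _ _ _ ⟩
    qbin (k ℕ.+ 0) k * (qfac k * 1#) * u
      ≈⟨ *-congʳ (qbin-qfac k zero) ⟩
    qfac (k ℕ.+ 0) * u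
      ≡⟨ cong (λ m → qfac (k ℕ.+ 0) * (1# - q ^ suc m)) (ℕ.+-identityʳ k) ⟨
    qfac (suc k ℕ.+ 0)  ∎
    where u = 1# - q ^ suc k
  qbin-qfac (suc k) (suc l) = begin
    (qbin (k ℕ.+ suc l) k + q ^ suc k * qbin (k ℕ.+ suc l) (suc k)) * (qfac k * u * (qfac l * v))
      ≈⟨ solve 7 (λ b c p f u g v → (b :+ p :* c) :* (f :* u :* (g :* v)) := b :* (f :* (g :* v)) :* u :+ p :* (c :* (f :* u :* g) :* v)) refl _ _ _ _ _ _ _ ⟩
    qbin (k ℕ.+ suc l) k * (qfac k * (qfac l * v)) * u
      + q ^ suc k * (qbin (k ℕ.+ suc l) (suc k) * (qfac k * u * qfac l) * v)
      ≈⟨ +-cong (*-congʳ (qbin-qfac k (suc l))) (*-congˡ (*-congʳ (trans (*-congʳ (reflexive (cong (λ m → qbin m (suc k)) (ℕ.+-suc k l)))) (trans (qbin-qfac (suc k) l) (reflexive (cong qfac (≡.sym (ℕ.+-suc k l)))))))) ⟩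
    F * u + q ^ suc k * (F * v)
      ≈⟨ solve 4 (λ f u p v → f :* u :+ p :* (f :* v) := f :* (u :+ p :* v)) refl _ _ _ _ ⟩
    F * (u + q ^ suc k * v)
      ≈⟨ *-congˡ (1-q^-split (suc k) (suc l)) ⟩
    F * (1# - q ^ (suc k ℕ.+ suc l))  ∎
    where
    u = 1# - q ^ suc k
    v = 1# - q ^ suc l
    F = qfac (k ℕ.+ suc l)

  module Nilpotent (n : ℕ) (q^-nil : q ^ suc n ≈ 0#) where

    q^-vanish : ∀ m → n ℕ.< m → q ^ m ≈ 0#
    q^-vanish m n<m = begin
      q ^ m                           ≡⟨ cong (q ^_) (ℕ.m+[n∸m]≡n n<m) ⟨
      q ^ (suc n ℕ.+ (m ℕ.∸ suc n))   ≈⟨ ^-homo-* q (suc n) _ ⟩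
      q ^ suc n * q ^ (m ℕ.∸ suc n)   ≈⟨ trans (*-congʳ q^-nil) (zeroˡ _) ⟩
      0#                              ∎

    qfac-stable-+ : ∀ d → qfac (d ℕ.+ n) ≈ qfac n
    qfac-stable-+ zero    = refl
    qfac-stable-+ (suc d) = begin
      qfac (d ℕ.+ n) * (1# - q ^ suc (d ℕ.+ n))  ≈⟨ *-cong (qfac-stable-+ d) (+-congˡ (-‿cong (q^-vanish _ (s≤s (ℕ.m≤n+m n d))))) ⟩
      qfac n * (1# - 0#)                         ≈⟨ *-congˡ (trans (+-congˡ -0#≈0#) (+-identityʳ 1#)) ⟩
      qfac n * 1#                                ≈⟨ *-identityʳ _ ⟩
      qfac n                                     ∎

    qfac-stable : ∀ m → n ℕ.≤ m → qfac m ≈ qfac n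
    qfac-stable m n≤m = trans (reflexive (cong qfac (≡.sym (ℕ.m∸n+n≡m n≤m)))) (qfac-stable-+ (m ℕ.∸ n))

    geometric : Carrier → ℕ → Carrier
    geometric y zero    = 0#
    geometric y (suc m) = 1# + y * geometric y m

    geometric-sum : ∀ y m → (1# - y) * geometric y m ≈ 1# - y ^ m
    geometric-sum y zero    = trans (zeroʳ _) (sym (-‿inverseʳ 1#))
    geometric-sum y (suc m) = begin
      (1# - y) * (1# + y * geometric y m)    ≈⟨ solve 3 (λ u y g → u :* (con 1 :+ y :* g) := u :+ y :* (u :* g)) refl (1# - y) y _ ⟩
      (1# - y) + y * ((1# - y) * geometric y m)  ≈⟨ +-congˡ (*-congˡ (geometric-sum y m)) ⟩
      (1# - y) + y * (1# - y ^ m)            ≈⟨ +-congˡ (trans (distribˡ _ _ _) (+-cong (*-identityʳ y) (sym (-‿distribʳ-* _ _)))) ⟩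
      (1# - y) + (y - y * y ^ m)             ≈⟨ solve 4 (λ o y y′ c → (o :+ y′) :+ (y :+ c) := (o :+ c) :+ (y′ :+ y)) refl 1# y (- y) (- (y * y ^ m)) ⟩
      (1# - y * y ^ m) + (- y + y)           ≈⟨ trans (+-congˡ (-‿inverseˡ _)) (+-identityʳ _) ⟩
      1# - y * y ^ m                         ∎

    -- Nilpotency of q passes to its power q^(j+1), so a finite geometric sum inverts 1 - q^(j+1).
    1-q^-unit : ∀ j → Σ[ u ∈ Carrier ] (1# - q ^ suc j) * u ≈ 1#
    1-q^-unit j = geometric (q ^ suc j) (suc n) , (begin
      (1# - q ^ suc j) * geometric (q ^ suc j) (suc n)  ≈⟨ geometric-sum _ (suc n) ⟩
      1# - (q * q ^ j) ^ suc n                          ≈⟨ +-congˡ (-‿cong (trans (*-^-distrib q (q ^ j) (suc n)) (trans (*-congʳ q^-nil) (zeroˡ _)))) ⟩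
      1# - 0#                                           ≈⟨ trans (+-congˡ -0#≈0#) (+-identityʳ 1#) ⟩
      1#                                                ∎)

    qfac-unit : ∀ m → Σ[ u ∈ Carrier ] qfac m * u ≈ 1#
    qfac-unit zero    = 1# , *-identityˡ 1#
    qfac-unit (suc m) with u , fu≈1 ← qfac-unit m | v , gv≈1 ← 1-q^-unit m =
      u * v , trans (solve 4 (λ f g u v → f :* g :* (u :* v) := f :* u :* (g :* v)) refl _ _ _ _)
                    (trans (*-cong fu≈1 gv≈1) (*-identityˡ 1#))

    -- Beyond n all q-factorials equal E = (q;q)_n, so `qbin-qfac` reads b E² = E; cancelling the
    -- unit E leaves E b = 1.
    qfac*qbin : ∀ k l → n ℕ.≤ k → n ℕ.≤ l → qfac n * qbin (k ℕ.+ l) k ≈ 1#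
    qfac*qbin k l n≤k n≤l with u , Eu≈1 ← qfac-unit n = begin
      E * b                ≈⟨ trans (*-congˡ Eu≈1) (*-identityʳ _) ⟨
      E * b * (E * u)      ≈⟨ solve 3 (λ e b u → e :* b :* (e :* u) := b :* (e :* e) :* u) refl E b u ⟩
      b * (E * E) * u      ≈⟨ *-congʳ (*-congˡ (*-cong (qfac-stable k n≤k) (qfac-stable l n≤l))) ⟨
      b * (qfac k * qfac l) * u  ≈⟨ *-congʳ (trans (qbin-qfac k l) (qfac-stable (k ℕ.+ l) (ℕ.m≤n⇒m≤n+o l n≤k))) ⟩
      E * u                ≈⟨ Eu≈1 ⟩
      1#                   ∎
      where
      E = qfac n
      b = qbin (k ℕ.+ l) k

    q^triangle-vanish : ∀ d → n ℕ.< d → q ^ triangle d ≈ 0#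
    q^triangle-vanish d n<d = q^-vanish (triangle d) (ℕ.<-≤-trans n<d (n≤triangle d))

    -- Write k - N as d or as -1 - d. If d > n, the power of q vanishes because T(d) ≥ d. If d ≤ n,
    -- both k and 2N - k are at least n and `qfac*qbin` applies.
    qfac*qbin*q^tri : ∀ N k → n ℕ.+ suc n ℕ.≤ N → qfac n * (qbin (N ℕ.+ N) k * q ^ tri k N) ≈ q ^ tri k N
    qfac*qbin*q^tri N k 2n<N with N ℕ.≤? k
    ... | yes N≤k with d , ≡.refl ← ℕ.m≤n⇒∃[o]m+o≡n N≤k | d ℕ.≤? n
    ...   | no d≰n = trans (*-congˡ (trans (*-congˡ vanish) (zeroʳ _))) (trans (zeroʳ _) (sym vanish))
      where
      vanish : q ^ tri (N ℕ.+ d) N ≈ 0#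
      vanish = trans (reflexive (cong (q ^_) (tri-+ N d))) (q^triangle-vanish d (ℕ.≰⇒> d≰n))
    ...   | yes d≤n = trans (sym (*-assoc _ _ _)) (trans (*-congʳ (trans (*-congˡ (reflexive (cong (λ m → qbin m (N ℕ.+ d)) total)))
        (qfac*qbin (N ℕ.+ d) (N ℕ.∸ d) (ℕ.m≤n⇒m≤n+o d n≤N) n≤N∸d))) (*-identityˡ _))
      where
      n≤N : n ℕ.≤ N
      n≤N = ℕ.≤-trans (ℕ.m≤m+n n (suc n)) 2n<N
      n≤N∸d : n ℕ.≤ N ℕ.∸ d
      n≤N∸d = ℕ.m+n≤o⇒m≤o∸n n (ℕ.≤-trans (ℕ.+-monoʳ-≤ n (ℕ.m≤n⇒m≤1+n d≤n)) 2n<N)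
      total : N ℕ.+ N ≡ N ℕ.+ d ℕ.+ (N ℕ.∸ d)
      total = ≡.trans (cong (N ℕ.+_) (≡.sym (ℕ.m+[n∸m]≡n (ℕ.≤-trans d≤n n≤N)))) (≡.sym (ℕ.+-assoc N d _))
    qfac*qbin*q^tri N k 2n<N | no N≰k with d , ≡.refl ← ℕ.m≤n⇒∃[o]m+o≡n (ℕ.≰⇒> N≰k) | d ℕ.≤? n
    ...   | no d≰n = trans (*-congˡ (trans (*-congˡ vanish) (zeroʳ _))) (trans (zeroʳ _) (sym vanish))
      where
      vanish : q ^ tri k (suc (k ℕ.+ d)) ≈ 0#
      vanish = trans (reflexive (cong (q ^_) (tri-+-suc k d))) (q^triangle-vanish d (ℕ.≰⇒> d≰n))
    ...   | yes d≤n = trans (sym (*-assoc _ _ _)) (trans (*-congʳ (trans (*-congˡ (reflexive (cong (λ m → qbin m k) total)))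
        (qfac*qbin k (suc d ℕ.+ suc (k ℕ.+ d)) n≤k (ℕ.m≤n⇒m≤o+n (suc d) (ℕ.≤-trans n≤k (ℕ.m≤n⇒m≤1+n (ℕ.m≤m+n k d))))))) (*-identityˡ _))
      where
      -- Here k = N - d - 1 with d ≤ n; the bound N ≥ 2n + 1 is just enough for k ≥ n.
      n≤k : n ℕ.≤ k
      n≤k = ℕ.+-cancelʳ-≤ (suc n) n k (ℕ.≤-trans 2n<N (ℕ.≤-trans (s≤s (ℕ.+-monoʳ-≤ k d≤n)) (ℕ.≤-reflexive (≡.sym (ℕ.+-suc k n)))))
      total : suc (k ℕ.+ d) ℕ.+ suc (k ℕ.+ d) ≡ k ℕ.+ (suc d ℕ.+ suc (k ℕ.+ d))
      total = ≡.trans (cong (ℕ._+ suc (k ℕ.+ d)) (≡.sym (ℕ.+-suc k d))) (ℕ.+-assoc k (suc d) _)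

-- The series variable X plays the role of z; lower b · upper 1# a is zᵇ times the finite triple
-- product ∏_{1≤j≤a} (1 + z qʲ) ∏_{0≤j<b} (1 + z⁻¹ qʲ).
module FiniteTripleProduct (R : Ring) (q : CommutativeRing.Carrier R) (K : ℕ) where
  open RingKit R
  open QBinomial R q
  open Series R K
  private module S = RingKit series

  linear : Carrier → Carrier → ℕ → Carrier
  linear u v zero          = u
  linear u v (suc zero)    = v
  linear u v (suc (suc _)) = 0#

  linear-·-suc : ∀ u v f k → (linear u v · f) (suc k) ≈ u * f (suc k) + v * f k
  linear-·-suc u v f k = +-congˡ (trans
    (·-cong≤ k {f′ = const v} {g′ = f} (λ { zero _ → refl ; (suc i) _ → refl }) (λ _ _ → refl))
    (const-· v f k))

  linear-≈ : ∀ u v → linear u v S.≈ (const u S.+ X · const v)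
  linear-≈ u v zero          _ = sym (trans (+-congˡ (X-· (const v) 0)) (+-identityʳ u))
  linear-≈ u v (suc zero)    _ = sym (trans (+-congˡ (X-· (const v) 1)) (+-identityˡ v))
  linear-≈ u v (suc (suc i)) _ = sym (trans (+-congˡ (X-· (const v) (suc (suc i)))) (+-identityˡ 0#))

  -- The parameter y, which multiplies z in every factor, closes the family under removal of the
  -- factor j = 1: what remains is the product at yq, as `upper-shift` records.
  upper : Carrier → ℕ → ℕ → Carrier
  upper y zero    = const 1#
  upper y (suc a) = linear 1# (y * q ^ suc a) · upper y a

  lower : ℕ → ℕ → Carrier
  lower zero    = const 1#
  lower (suc b) = linear (q ^ b) 1# · lower b

  upper-shift : ∀ y a → upper y (suc a) S.≈ linear 1# (y * q) · upper (y * q) a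
  upper-shift y zero = S.*-congʳ {const 1#} (λ { zero _ → refl ; (suc zero) _ → *-congˡ (*-identityʳ q) ; (suc (suc i)) _ → refl })
  upper-shift y (suc a) = S.trans {upper y (suc (suc a))} {L₁ · (L₂ · U)}
    (S.*-cong {L₁′} {L₁} {upper y (suc a)} {L₂ · U}
      (λ { zero _ → refl ; (suc zero) _ → sym (*-assoc y q _) ; (suc (suc i)) _ → refl }) (upper-shift y a))
    (S.trans {L₁ · (L₂ · U)} {L₁ · L₂ · U} (S.sym (S.*-assoc L₁ L₂ U))
      (S.trans {L₁ · L₂ · U} {L₂ · L₁ · U} (S.*-congʳ {U} (S.*-comm L₁ L₂)) (S.*-assoc L₂ L₁ U)))
    where
    L₁ = linear 1# (y * q * q ^ suc a)
    L₁′ = linear 1# (y * q ^ suc (suc a))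
    L₂ = linear 1# (y * q)
    U  = upper (y * q) a

  -- The q-binomial theorem. Removing the factor j = 1 replaces y by yq, and the resulting q^(k+1)
  -- is the one in the Pascal rule of `qbin`.
  upper-coeff : ∀ a y k → k ℕ.≤ K → upper y a k ≈ qbin a k * (q ^ triangle k * y ^ k)
  upper-coeff zero    y zero    _  = sym (trans (*-identityˡ _) (*-identityˡ _))
  upper-coeff zero    y (suc k) _  = sym (zeroˡ _)
  upper-coeff (suc a) y zero    le = begin
    upper y (suc a) 0        ≈⟨ *-identityˡ _ ⟩
    upper y a 0              ≈⟨ upper-coeff a y 0 le ⟩
    1# * (1# * 1#)           ∎
  upper-coeff (suc a) y (suc k) le = begin
    upper y (suc a) (suc k)
      ≈⟨ upper-shift y a (suc k) le ⟩
    (linear 1# (y * q) · upper (y * q) a) (suc k)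
      ≈⟨ linear-·-suc 1# (y * q) (upper (y * q) a) k ⟩
    1# * upper (y * q) a (suc k) + y * q * upper (y * q) a k
      ≈⟨ +-cong (*-congˡ (trans (upper-coeff a (y * q) (suc k) le) (*-congˡ (*-congˡ (*-^-distrib y q (suc k))))))
                (*-congˡ (trans (upper-coeff a (y * q) k (ℕ.<⇒≤ le)) (*-congˡ (*-congˡ (*-^-distrib y q k))))) ⟩
    1# * (qbin a (suc k) * (q ^ triangle (suc k) * (y ^ suc k * q ^ suc k))) + y * q * (qbin a k * (q ^ triangle k * (y ^ k * q ^ k)))
      ≈⟨ +-congˡ (solve 6 (λ y q b t p r → y :* q :* (b :* (t :* (p :* r))) := b :* (q :* r :* t :* (y :* p))) refl _ _ _ _ _ _) ⟩
    1# * (qbin a (suc k) * (q ^ triangle (suc k) * (y ^ suc k * q ^ suc k))) + qbin a k * (q ^ suc k * q ^ triangle k * y ^ suc k)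
      ≈⟨ +-congˡ (*-congˡ (*-congʳ (^-homo-* q (suc k) (triangle k)))) ⟨
    1# * (qbin a (suc k) * (q ^ triangle (suc k) * (y ^ suc k * q ^ suc k))) + qbin a k * (q ^ triangle (suc k) * y ^ suc k)
      ≈⟨ solve 5 (λ b t p r c → con 1 :* (b :* (t :* (p :* r))) :+ c :* (t :* p) := (c :+ r :* b) :* (t :* p)) refl _ _ _ _ _ ⟩
    (qbin a k + q ^ suc k * qbin a (suc k)) * (q ^ triangle (suc k) * y ^ suc k)  ∎

  -- A further factor q^b + z combines two neighbouring coefficients, and `tri-suc` turns q^b
  -- q^T(k+1-b) into q^(k+1) q^T(k-b), so the Pascal rule closes the induction on b.
  lower-·-upper-coeff : ∀ a b k → k ℕ.≤ K → (lower b · upper 1# a) k ≈ qbin (a ℕ.+ b) k * q ^ tri k b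
  lower-·-upper-coeff a zero k le = begin
    (const 1# · upper 1# a) k                 ≈⟨ ·-identityˡ (upper 1# a) k ⟩
    upper 1# a k                              ≈⟨ upper-coeff a 1# k le ⟩
    qbin a k * (q ^ triangle k * 1# ^ k)      ≈⟨ *-congˡ (trans (*-congˡ (1^ k)) (*-identityʳ _)) ⟩
    qbin a k * q ^ triangle k                 ≡⟨ cong (λ m → qbin m k * q ^ triangle k) (ℕ.+-identityʳ a) ⟨
    qbin (a ℕ.+ 0) k * q ^ triangle k         ∎
  lower-·-upper-coeff a (suc b) zero le = begin
    (linear (q ^ b) 1# · lower b · upper 1# a) 0     ≈⟨ *-assoc _ _ _ ⟩
    q ^ b * (lower b · upper 1# a) 0                 ≈⟨ *-congˡ (trans (lower-·-upper-coeff a b 0 le) (*-identityˡ _)) ⟩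
    q ^ b * q ^ tri 0 b                              ≈⟨ ^-homo-* q b (tri 0 b) ⟨
    q ^ (b ℕ.+ tri 0 b)                              ≡⟨ cong (q ^_) (tri-suc 0 b) ⟩
    q ^ tri 0 (suc b)                                ≈⟨ *-identityˡ _ ⟨
    1# * q ^ tri 0 (suc b)                           ∎
  lower-·-upper-coeff a (suc b) (suc k) le = begin
    (linear (q ^ b) 1# · lower b · upper 1# a) (suc k)
      ≈⟨ ·-assoc (linear (q ^ b) 1#) (lower b) (upper 1# a) (suc k) ⟩
    (linear (q ^ b) 1# · (lower b · upper 1# a)) (suc k)
      ≈⟨ linear-·-suc (q ^ b) 1# (lower b · upper 1# a) k ⟩
    q ^ b * (lower b · upper 1# a) (suc k) + 1# * (lower b · upper 1# a) k
      ≈⟨ +-cong (*-congˡ (lower-·-upper-coeff a b (suc k) le)) (*-congˡ (lower-·-upper-coeff a b k (ℕ.<⇒≤ le))) ⟩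
    q ^ b * (B′ * q ^ tri (suc k) b) + 1# * (B * q ^ tri k b)
      ≈⟨ +-congʳ (trans (solve 3 (λ p b t → p :* (b :* t) := p :* t :* b) refl _ _ _) (*-congʳ powers)) ⟩
    q ^ suc k * q ^ tri k b * B′ + 1# * (B * q ^ tri k b)
      ≈⟨ solve 4 (λ p t b′ b → p :* t :* b′ :+ con 1 :* (b :* t) := (b :+ p :* b′) :* t) refl _ _ _ _ ⟩
    (B + q ^ suc k * B′) * q ^ tri k b
      ≡⟨ cong (λ m → qbin m (suc k) * q ^ tri k b) (ℕ.+-suc a b) ⟨
    qbin (a ℕ.+ suc b) (suc k) * q ^ tri k b  ∎
    where
    B  = qbin (a ℕ.+ b) k
    B′ = qbin (a ℕ.+ b) (suc k)
    powers : q ^ b * q ^ tri (suc k) b ≈ q ^ suc k * q ^ tri k b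
    powers = trans (sym (^-homo-* q b (tri (suc k) b)))
      (trans (reflexive (cong (q ^_) (tri-suc (suc k) b))) (^-homo-* q (suc k) (tri k b)))

-- Sums over lists and coefficient extraction

index-∈-lookup : {A : Set} (xs : List A) (i : Fin (length xs)) → index (∈-lookup {xs = xs} i) ≡ i
index-∈-lookup (x ∷ xs) Fin.zero    = ≡.refl
index-∈-lookup (x ∷ xs) (Fin.suc i) = cong Fin.suc (index-∈-lookup xs i)

Σ-≡ : {A : Set} {P : A → Set} → (∀ a (p p′ : P a) → p ≡ p′) →
      {x y : Σ A P} → proj₁ x ≡ proj₁ y → x ≡ y
Σ-≡ irr {a , p} {_ , p′} ≡.refl = cong (a ,_) (irr a p p′)

-- An element goes to its position in the list. Membership in a duplicate-free list is
-- propositional, so that position does not depend on how completeness was proved.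
fin-↔-enumerated : {A : Set} {P : A → Set} → (∀ a (p p′ : P a) → p ≡ p′) →
  ∀ {xs} → Unique xs → (∀ {a} → a ∈ xs → P a) → (∀ {a} → P a → a ∈ xs) → Fin (length xs) ↔ Σ A P
fin-↔-enumerated irr {xs} unique sound complete = mk↔ₛ′
  (λ i → lookup xs i , sound (∈-lookup i))
  (λ (_ , p) → index (complete p))
  (λ (_ , p) → Σ-≡ irr (≡.sym (lookup-index (complete p))))
  (λ i → ≡.trans (cong index (unique⇒irrelevant unique (complete (sound (∈-lookup i))) (∈-lookup i))) (index-∈-lookup xs i))

module ListSum (R : Ring) where
  open RingKit R

  lsum : {A : Set} → (A → Carrier) → List A → Carrier
  lsum φ []       = 0#
  lsum φ (x ∷ xs) = φ x + lsum φ xs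

  lsum-cong : {A : Set} {φ ψ : A → Carrier} → ∀ {xs} → All (λ x → φ x ≈ ψ x) xs → lsum φ xs ≈ lsum ψ xs
  lsum-cong []       = refl
  lsum-cong (e ∷ es) = +-cong e (lsum-cong es)

  lsum-++ : {A : Set} (φ : A → Carrier) → ∀ xs ys → lsum φ (xs ++ ys) ≈ lsum φ xs + lsum φ ys
  lsum-++ φ []       ys = sym (+-identityˡ _)
  lsum-++ φ (x ∷ xs) ys = trans (+-congˡ (lsum-++ φ xs ys)) (sym (+-assoc _ _ _))

  lsum-map : {A B : Set} (φ : B → Carrier) (f : A → B) → ∀ xs → lsum φ (map f xs) ≡ lsum (φ ∘ f) xs
  lsum-map φ f []       = ≡.refl
  lsum-map φ f (x ∷ xs) = cong (λ s → φ (f x) + s) (lsum-map φ f xs)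

  lsum-*ˡ : {A : Set} (c : Carrier) (φ : A → Carrier) → ∀ xs → lsum (λ x → c * φ x) xs ≈ c * lsum φ xs
  lsum-*ˡ c φ []       = sym (zeroʳ c)
  lsum-*ˡ c φ (x ∷ xs) = trans (+-congˡ (lsum-*ˡ c φ xs)) (sym (distribˡ _ _ _))

  lsum-cartesianProduct : {A B : Set} (φ : A → Carrier) (ψ : B → Carrier) → ∀ xs ys →
    lsum (λ (x , y) → φ x * ψ y) (cartesianProduct xs ys) ≈ lsum φ xs * lsum ψ ys
  lsum-cartesianProduct φ ψ []       ys = sym (zeroˡ _)
  lsum-cartesianProduct φ ψ (x ∷ xs) ys = begin
    lsum φψ (map (x ,_) ys ++ cartesianProduct xs ys)            ≈⟨ lsum-++ φψ (map (x ,_) ys) _ ⟩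
    lsum φψ (map (x ,_) ys) + lsum φψ (cartesianProduct xs ys)   ≈⟨ +-cong (trans (reflexive (lsum-map φψ (x ,_) ys)) (lsum-*ˡ (φ x) ψ ys)) (lsum-cartesianProduct φ ψ xs ys) ⟩
    φ x * lsum ψ ys + lsum φ xs * lsum ψ ys                      ≈⟨ distribʳ _ _ _ ⟨
    (φ x + lsum φ xs) * lsum ψ ys                                ∎
    where
    φψ = λ (p : _ × _) → φ (proj₁ p) * ψ (proj₂ p)

  lprod : {A : Set} → (A → Carrier) → List A → Carrier
  lprod φ []       = 1#
  lprod φ (x ∷ xs) = φ x * lprod φ xs

module MonomialSum (R : Ring) (K : ℕ) where
  open RingKit R
  open Series R K
  open ListSum R
  private
    module S = RingKit series
    module SL = ListSum series

  lsum-coeff : {A : Set} (φ : A → ℕ → Carrier) → ∀ xs i → SL.lsum φ xs i ≡ lsum (λ x → φ x i) xs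
  lsum-coeff φ []       i = ≡.refl
  lsum-coeff φ (x ∷ xs) i = cong (λ s → φ x i + s) (lsum-coeff φ xs i)

  lsum-if : {A : Set} (a : A → ℕ) (c : A → Carrier) → ∀ k xs →
    lsum (λ x → if does (a x ℕ.≟ k) then c x else 0#) xs ≈ lsum c (filter (λ x → a x ℕ.≟ k) xs)
  lsum-if a c k []       = refl
  lsum-if a c k (x ∷ xs) with does (a x ℕ.≟ k)
  ... | true  = +-congˡ (lsum-if a c k xs)
  ... | false = trans (+-identityˡ _) (lsum-if a c k xs)

  -- Turns extraction of a power of z into a side condition on the objects summed over; the
  -- equal-length and zero-sum constraints both enter in this way.
  lsum-monomials-coeff : {A : Set} (a : A → ℕ) (c : A → Carrier) → ∀ k xs →
    SL.lsum (λ x → X S.^ a x · const (c x)) xs k ≈ lsum c (filter (λ x → a x ℕ.≟ k) xs)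
  lsum-monomials-coeff a c k xs = begin
    SL.lsum (λ x → X S.^ a x · const (c x)) xs k              ≡⟨ lsum-coeff _ xs k ⟩
    lsum (λ x → (X S.^ a x · const (c x)) k) xs               ≈⟨ lsum-cong {xs = xs} (All.universal (λ x → X^-const (a x) (c x) k) xs) ⟩
    lsum (λ x → if does (a x ℕ.≟ k) then c x else 0#) xs      ≈⟨ lsum-if a c k xs ⟩
    lsum c (filter (λ x → a x ℕ.≟ k) xs)                      ∎

  lsum-applyUpTo : ∀ (φ : ℕ → ℕ → Carrier) g m → SL.lsum φ (applyUpTo g m) ≡ SL.lsum (φ ∘ g) (upTo m)
  lsum-applyUpTo φ g zero    = ≡.refl
  lsum-applyUpTo φ g (suc m) = cong (λ s → φ (g 0) S.+ s)
    (≡.trans (lsum-applyUpTo φ (g ∘ suc) m) (≡.sym (lsum-applyUpTo (φ ∘ g) suc m)))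

  -- Puts the theta series into the form of a sum of monomials, whose fourth power expands over
  -- quadruples. Splitting off the constant term leaves z times the same sum for `f ∘ suc`.
  series-as-lsum : ∀ f m i → i ℕ.< m → SL.lsum (λ k → X S.^ k · const (f k)) (upTo m) i ≈ f i
  series-as-lsum f (suc m) i i<m = begin
    (const 1# · const (f 0)) i + SL.lsum (λ k → X S.^ k · const (f k)) (applyUpTo suc m) i
      ≡⟨ cong (λ s → (const 1# · const (f 0)) i + s i) (lsum-applyUpTo (λ k → X S.^ k · const (f k)) suc m) ⟩
    (const 1# · const (f 0)) i + SL.lsum (λ k → X · X S.^ k · const (f (suc k))) (upTo m) i
      ≈⟨ +-cong (·-identityˡ (const (f 0)) i) (trans (reflexive (lsum-coeff _ (upTo m) i)) (trans
           (lsum-cong {xs = upTo m} (All.universal (λ k → ·-assoc X (X S.^ k) (const (f (suc k))) i) (upTo m)))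
           (reflexive (≡.sym (lsum-coeff (λ k → X · (X S.^ k · const (f (suc k)))) (upTo m) i))))) ⟩
    const (f 0) i + SL.lsum (λ k → X · (X S.^ k · const (f (suc k)))) (upTo m) i
      ≈⟨ +-congˡ (trans (factor (upTo m) i) (X-· (SL.lsum (λ k → X S.^ k · const (f (suc k))) (upTo m)) i)) ⟩
    const (f 0) i + shift (SL.lsum (λ k → X S.^ k · const (f (suc k))) (upTo m)) i
      ≈⟨ tail i i<m ⟩
    f i ∎
    where
    factor : ∀ ks i → SL.lsum (λ k → X · (X S.^ k · const (f (suc k)))) ks i
                    ≈ (X · SL.lsum (λ k → X S.^ k · const (f (suc k))) ks) i
    factor []       i = sym (trans (X-· (λ _ → 0#) i) (shift-0 i))
      where
      shift-0 : ∀ i → shift (λ _ → 0#) i ≈ 0#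
      shift-0 zero    = refl
      shift-0 (suc i) = refl
    factor (k ∷ ks) i = trans (+-congˡ (factor ks i)) (trans (sym (+-cong (·-comm _ X i) (·-comm _ X i)))
      (trans (sym (·-distribʳ X _ _ i)) (·-comm _ X i)))
    tail : ∀ i → i ℕ.< suc m → const (f 0) i + shift (SL.lsum (λ k → X S.^ k · const (f (suc k))) (upTo m)) i ≈ f i
    tail zero    _         = +-identityʳ _
    tail (suc i) (s≤s i<m) = trans (+-identityˡ _) (series-as-lsum (f ∘ suc) m i i<m)

length-as-lsum : {A : Set} (xs : List A) → ListSum.lsum ℤ.+-*-commutativeRing (λ _ → + 1) xs ≡ + length xs
length-as-lsum []       = ≡.refl
length-as-lsum (x ∷ xs) = cong (λ m → + 1 ℤ.+ m) (length-as-lsum xs)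

-- Enumeration of Frobenius partitions

subs : {A : Set} → List A → List (List A)
subs []       = [] ∷ []
subs (x ∷ xs) = map (x ∷_) (subs xs) ++ subs xs

module _ {A : Set} where

  subs-all : {P : A → Set} → ∀ {xs} → All P xs → All (All P) (subs xs)
  subs-all []         = [] ∷ []
  subs-all (px ∷ pxs) = All.++⁺ (All.map⁺ (All.map (px ∷_) (subs-all pxs))) (subs-all pxs)

  subs-allPairs : {R : A → A → Set} → ∀ {xs} → AllPairs R xs → All (AllPairs R) (subs xs)
  subs-allPairs []         = [] ∷ []
  subs-allPairs (px ∷ pxs) = All.++⁺
    (All.map⁺ (All.zipWith (λ (a , p) → a ∷ p) (subs-all px , subs-allPairs pxs))) (subs-allPairs pxs)

  subs-length : (xs : List A) → All (λ s → length s ℕ.≤ length xs) (subs xs)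
  subs-length []       = z≤n ∷ []
  subs-length (x ∷ xs) = All.++⁺ (All.map⁺ (All.map s≤s (subs-length xs))) (All.map ℕ.m≤n⇒m≤1+n (subs-length xs))

  subs-unique : {xs : List A} → Unique xs → Unique (subs xs)
  subs-unique {[]}     _               = [] ∷ []
  subs-unique {x ∷ xs} (x∉xs ∷ unique) = Unique.++⁺
    (Unique.map⁺ (λ { ≡.refl → ≡.refl }) (subs-unique unique)) (subs-unique unique)
    (λ (s∈map , s∈subs) → disjoint s∈map s∈subs)
    where
    disjoint : ∀ {s} → s ∈ map (x ∷_) (subs xs) → s ∈ subs xs → ⊥
    disjoint s∈map s∈subs with _ , _ , ≡.refl ← ∈-map⁻ (x ∷_) s∈map =
      All.lookup x∉xs (All.head (All.lookup (subs-all (All.tabulate id)) s∈subs)) ≡.refl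

  -- If both lists start with x, the rest of `s` lies strictly after x and so in `xs`; if `s` starts
  -- later, transitivity puts all of `s` after x. Irreflexivity excludes x in both cases.
  subs-complete : {R : A → A → Set} → (∀ {x y z} → R x y → R y z → R x z) → (∀ {x} → ¬ R x x) →
    ∀ {xs s} → AllPairs R xs → AllPairs R s → All (_∈ xs) s → s ∈ subs xs
  subs-complete tr irr {[]}     {[]}    _          _            _         = here ≡.refl
  subs-complete tr irr {[]}     {_ ∷ _} _          _            (() ∷ _)
  subs-complete tr irr {x ∷ xs} {[]}    (_ ∷ Rxs)  _            _         = ∈-++⁺ʳ _ (subs-complete tr irr Rxs [] [])
  subs-complete tr irr {x ∷ xs} {y ∷ s} (Rx ∷ Rxs) (Ry ∷ Rs) (here ≡.refl ∷ ins) =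
    ∈-++⁺ˡ (∈-map⁺ (x ∷_) (subs-complete tr irr Rxs Rs (All.zipWith avoid (Ry , ins))))
    where
    avoid : ∀ {z} → _ × z ∈ x ∷ xs → z ∈ xs
    avoid (Rxz , here ≡.refl) = ⊥-elim (irr Rxz)
    avoid (_   , there z∈xs)  = z∈xs
  subs-complete {R} tr irr {x ∷ xs} {y ∷ s} (Rx ∷ Rxs) (Ry ∷ Rs) (there y∈xs ∷ ins) =
    ∈-++⁺ʳ _ (subs-complete tr irr Rxs (Ry ∷ Rs) (y∈xs ∷ All.zipWith avoid (Ry , ins)))
    where
    avoid : ∀ {z} → R y z × z ∈ x ∷ xs → z ∈ xs
    avoid (Ryz , here ≡.refl) = ⊥-elim (irr (tr (All.lookup Rx y∈xs) Ryz))
    avoid (_   , there z∈xs)  = z∈xs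

≻-trans : ∀ {k} {x y z : Colored k} → x ≻ y → y ≻ z → x ≻ z
≻-trans (inj₁ p)            (inj₁ q)            = inj₁ (ℕ.<-trans q p)
≻-trans (inj₁ p)            (inj₂ (≡.refl , _)) = inj₁ p
≻-trans (inj₂ (≡.refl , _)) (inj₁ q)            = inj₁ q
≻-trans (inj₂ (≡.refl , c)) (inj₂ (≡.refl , d)) = inj₂ (≡.refl , ℕ.<-trans d c)

≻-irrefl : ∀ {k} {x : Colored k} → ¬ x ≻ x
≻-irrefl (inj₁ p)       = ℕ.<-irrefl ≡.refl p
≻-irrefl (inj₂ (_ , c)) = ℕ.<-irrefl ≡.refl c

≻-irrelevant : ∀ {k} {x y : Colored k} (p p′ : x ≻ y) → p ≡ p′
≻-irrelevant (inj₁ p)       (inj₁ p′)        = cong inj₁ (ℕ.<-irrelevant p p′)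
≻-irrelevant (inj₁ p)       (inj₂ (e , _))   = ⊥-elim (ℕ.<-irrefl e p)
≻-irrelevant (inj₂ (e , _)) (inj₁ p′)        = ⊥-elim (ℕ.<-irrefl e p′)
≻-irrelevant (inj₂ (e , c)) (inj₂ (e′ , c′)) = cong inj₂ (cong₂ _,_ (≡-irrelevant e e′) (ℕ.<-irrelevant c c′))

pattern 0F = Fin.zero
pattern 1F = Fin.suc 0F
pattern 2F = Fin.suc 1F
pattern 3F = Fin.suc 2F

-- Listed in decreasing order, so that the admissible rows with values below N are exactly the
-- sublists.
palette : ℕ → List (Colored 4)
palette zero    = []
palette (suc N) = (N , 3F) ∷ (N , 2F) ∷ (N , 1F) ∷ (N , 0F) ∷ palette N

palette-bound : ∀ N → All (λ x → proj₁ x ℕ.< N) (palette N)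
palette-bound zero    = []
palette-bound (suc N) = ≤-refl ∷ ≤-refl ∷ ≤-refl ∷ ≤-refl ∷ All.map ℕ.m≤n⇒m≤1+n (palette-bound N)
  where ≤-refl = ℕ.≤-refl {suc N}

palette-complete : ∀ N {l} (c : Fin 4) → l ℕ.< N → (l , c) ∈ palette N
palette-complete (suc N) {l} c (s≤s l≤N) with ℕ.m≤n⇒m<n∨m≡n l≤N
palette-complete (suc N) c  _ | inj₁ l<N    = there (there (there (there (palette-complete N c l<N))))
palette-complete (suc N) 0F _ | inj₂ ≡.refl = there (there (there (here ≡.refl)))
palette-complete (suc N) 1F _ | inj₂ ≡.refl = there (there (here ≡.refl))
palette-complete (suc N) 2F _ | inj₂ ≡.refl = there (here ≡.refl)
palette-complete (suc N) 3F _ | inj₂ ≡.refl = here ≡.refl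

palette-decreasing : ∀ N → AllPairs _≻_ (palette N)
palette-decreasing zero    = []
palette-decreasing (suc N) =
  (inj₂ (≡.refl , s≤s (s≤s (s≤s z≤n))) ∷ inj₂ (≡.refl , s≤s (s≤s z≤n)) ∷ inj₂ (≡.refl , s≤s z≤n) ∷ below) ∷
  (inj₂ (≡.refl , s≤s (s≤s z≤n)) ∷ inj₂ (≡.refl , s≤s z≤n) ∷ below) ∷
  (inj₂ (≡.refl , s≤s z≤n) ∷ below) ∷ below ∷ palette-decreasing N
  where
  below : ∀ {c} → All ((N , c) ≻_) (palette N)
  below = All.map inj₁ (palette-bound N)

palette-unique : ∀ N → Unique (palette N)
palette-unique N = AllPairs.map (λ { x≻x ≡.refl → ≻-irrefl x≻x }) (palette-decreasing N)

length-palette : ∀ N → length (palette N) ≡ 4 ℕ.* N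
length-palette zero    = ≡.refl
length-palette (suc N) = ≡.trans (cong (4 ℕ.+_) (length-palette N)) (≡.sym (ℕ.*-suc 4 N))

value-sum-bound : ∀ {k} (s : List (Colored k)) → All (λ x → proj₁ x ℕ.≤ value-sum s) s
value-sum-bound []      = []
value-sum-bound (x ∷ s) = ℕ.m≤m+n (proj₁ x) _ ∷ All.map (ℕ.m≤n⇒m≤o+n (proj₁ x)) (value-sum-bound s)

Rows : Set
Rows = List (Colored 4) × List (Colored 4)

rowWeight : Rows → ℕ
rowWeight (top , bottom) = length top ℕ.+ value-sum top ℕ.+ value-sum bottom

-- The bottom row enters through its complement in the palette, which avoids negative powers of z:
-- the two rows have the same length iff the charge is length (palette N).
charge : ℕ → Rows → ℕ
charge N (top , bottom) = length top ℕ.+ (length (palette N) ℕ.∸ length bottom)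

allRows : ℕ → List Rows
allRows N = cartesianProduct (subs (palette N)) (subs (palette N))

IsGFP : ℕ → Rows → Set
IsGFP n r@(top , bottom) = (Linked _≻_ top × Linked _≻_ bottom) × (length top ≡ length bottom × rowWeight r ≡ n)

IsGFP-irrelevant : ∀ n r (p p′ : IsGFP n r) → p ≡ p′
IsGFP-irrelevant n r ((a , b) , (c , d)) ((a′ , b′) , (c′ , d′)) = cong₂ _,_
  (cong₂ _,_ (Linked.irrelevant ≻-irrelevant a a′) (Linked.irrelevant ≻-irrelevant b b′))
  (cong₂ _,_ (≡-irrelevant c c′) (≡-irrelevant d d′))

GFP-↔ : ∀ n → Σ Rows (IsGFP n) ↔ GFP 4 n
GFP-↔ n = mk↔ₛ′
  (λ ((top , bottom) , ((a , b) , (c , d))) → record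
    { top = top ; bottom = bottom ; sameLength = c ; topDecreasing = a ; bottomDecreasing = b ; weight = d })
  (λ g → let open GFP g in (top , bottom) , ((topDecreasing , bottomDecreasing) , (sameLength , weight)))
  (λ _ → ≡.refl) (λ _ → ≡.refl)

-- The inner filter selects a power of z and the outer one a power of q, the order in which the
-- generating function is expanded.
gfps : ℕ → ℕ → List Rows
gfps N n = filter (λ r → rowWeight r ℕ.≟ n) (filter (λ r → charge N r ℕ.≟ length (palette N)) (allRows N))

-- No entry of a Frobenius partition of n exceeds n, so for n < N both rows are drawn from the
-- palette.
fin-↔-GFP : ∀ N n → n ℕ.< N → Fin (length (gfps N n)) ↔ GFP 4 n
fin-↔-GFP N n n<N = ↔-trans (fin-↔-enumerated (IsGFP-irrelevant n)
  (Unique.filter⁺ _ (Unique.filter⁺ _ (Unique.cartesianProduct⁺ U U))) sound complete) (GFP-↔ n)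
  where
  V = palette N
  U = subs-unique (palette-unique N)

  -- Truncated subtraction is exact for b ≤ v, which holds because the bottom row is a sublist of
  -- the palette.
  balanced : ∀ {a b v} → b ℕ.≤ v → a ℕ.+ (v ℕ.∸ b) ≡ v → a ≡ b
  balanced {a} {b} {v} b≤v e = ℕ.+-cancelʳ-≡ (v ℕ.∸ b) a b (≡.trans e (≡.sym (ℕ.m+[n∸m]≡n b≤v)))

  sound : ∀ {r} → r ∈ gfps N n → IsGFP n r
  sound {top , bottom} r∈
    with r∈′ , weight ← ∈-filter⁻ (λ r → rowWeight r ℕ.≟ n) r∈
    with r∈″ , charged ← ∈-filter⁻ (λ r → charge N r ℕ.≟ length V) {xs = allRows N} r∈′
    with t∈ , b∈ ← ∈-cartesianProduct⁻ (subs V) (subs V) r∈″ =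
      (decreasing t∈ , decreasing b∈) , (balanced (All.lookup (subs-length V) b∈) charged , weight)
    where
    decreasing : ∀ {s} → s ∈ subs V → Linked _≻_ s
    decreasing s∈ = AllPairs⇒Linked (All.lookup (subs-allPairs (palette-decreasing N)) s∈)

  row∈ : ∀ {s} → Linked _≻_ s → value-sum s ℕ.≤ n → s ∈ subs V
  row∈ {s} dec le = subs-complete {R = _≻_} ≻-trans ≻-irrefl (palette-decreasing N) (Linked⇒AllPairs ≻-trans dec)
    (All.map (λ {x} b → palette-complete N (proj₂ x) (ℕ.≤-<-trans (ℕ.≤-trans b le) n<N)) (value-sum-bound s))

  complete : ∀ {r} → IsGFP n r → r ∈ gfps N n
  complete {top , bottom} ((dt , db) , (sameLength , weight)) =
    ∈-filter⁺ (λ r → rowWeight r ℕ.≟ n)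
      (∈-filter⁺ (λ r → charge N r ℕ.≟ length V) (∈-cartesianProduct⁺ t∈ b∈) charged) weight
    where
    t∈ : top ∈ subs V
    t∈ = row∈ dt (ℕ.≤-trans (ℕ.m≤n+m _ (length top)) (ℕ.≤-trans (ℕ.m≤m+n _ (value-sum bottom)) (ℕ.≤-reflexive weight)))
    b∈ : bottom ∈ subs V
    b∈ = row∈ db (ℕ.≤-trans (ℕ.m≤n+m _ (length top ℕ.+ value-sum top)) (ℕ.≤-reflexive weight))
    charged : charge N (top , bottom) ≡ length V
    charged = ≡.trans (cong (λ l → l ℕ.+ (length V ℕ.∸ length bottom)) sameLength)
      (ℕ.m+[n∸m]≡n (All.lookup (subs-length V) b∈))

-- Row generating functions and the constant term in z.

module SubsProduct (R : Ring) where
  open RingKit R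
  open ListSum R

  -- Expanding the product chooses `φ x` when x is kept and `ψ x` when it is dropped. `W` also sees
  -- the ambient list because the bottom row is weighted by its complement, and the length bound
  -- keeps the truncated size of that complement exact.
  lsum-subs : {A : Set} (W : List A → List A → Carrier) (φ ψ : A → Carrier) → W [] [] ≈ 1# →
    (∀ x xs s → length s ℕ.≤ length xs → W (x ∷ xs) (x ∷ s) ≈ φ x * W xs s) →
    (∀ x xs s → length s ℕ.≤ length xs → W (x ∷ xs) s ≈ ψ x * W xs s) →
    ∀ xs → lsum (W xs) (subs xs) ≈ lprod (λ x → φ x + ψ x) xs
  lsum-subs W φ ψ e inn out []       = trans (+-identityʳ _) e
  lsum-subs W φ ψ e inn out (x ∷ xs) = begin
    lsum (W (x ∷ xs)) (map (x ∷_) (subs xs) ++ subs xs)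
      ≈⟨ lsum-++ (W (x ∷ xs)) (map (x ∷_) (subs xs)) (subs xs) ⟩
    lsum (W (x ∷ xs)) (map (x ∷_) (subs xs)) + lsum (W (x ∷ xs)) (subs xs)
      ≈⟨ +-cong (trans (reflexive (lsum-map (W (x ∷ xs)) (x ∷_) (subs xs))) (lsum-cong (All.map (λ {s} → inn x xs s) (subs-length xs))))
                (lsum-cong (All.map (λ {s} → out x xs s) (subs-length xs))) ⟩
    lsum (λ s → φ x * W xs s) (subs xs) + lsum (λ s → ψ x * W xs s) (subs xs)
      ≈⟨ +-cong (lsum-*ˡ (φ x) (W xs) (subs xs)) (lsum-*ˡ (ψ x) (W xs) (subs xs)) ⟩
    φ x * lsum (W xs) (subs xs) + ψ x * lsum (W xs) (subs xs)
      ≈⟨ distribʳ _ _ _ ⟨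
    (φ x + ψ x) * lsum (W xs) (subs xs)
      ≈⟨ *-congˡ (lsum-subs W φ ψ e inn out xs) ⟩
    (φ x + ψ x) * lprod (λ x → φ x + ψ x) xs  ∎

  -- All four colours of a value share one factor; `P` is the product for a single colour.
  lprod-palette : (φ : Colored 4 → Carrier) (g : ℕ → Carrier) (P : ℕ → Carrier) →
    (∀ l c → φ (l , c) ≈ g l) → P 0 ≈ 1# → (∀ l → P (suc l) ≈ g l * P l) →
    ∀ N → lprod φ (palette N) ≈ P N ⁴
  lprod-palette φ g P φ≈g P0 Ps zero    = sym (trans (⁴-cong P0) (trans (*-identityˡ _) (trans (*-identityˡ _) (*-identityˡ _))))
  lprod-palette φ g P φ≈g P0 Ps (suc N) = begin
    φ (N , 3F) * (φ (N , 2F) * (φ (N , 1F) * (φ (N , 0F) * lprod φ (palette N))))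
      ≈⟨ *-cong (φ≈g N 3F) (*-cong (φ≈g N 2F) (*-cong (φ≈g N 1F) (*-cong (φ≈g N 0F) (lprod-palette φ g P φ≈g P0 Ps N)))) ⟩
    g N * (g N * (g N * (g N * P N ⁴)))
      ≈⟨ solve 2 (λ g p → g :* (g :* (g :* (g :* (p :* (p :* (p :* p)))))) := g :* p :* (g :* p :* (g :* p :* (g :* p)))) refl (g N) (P N) ⟩
    (g N * P N) ⁴  ≈⟨ ⁴-cong (Ps N) ⟨
    P (suc N) ⁴    ∎

-- Four exponents k = m + N of z, encoding a vector m of ℤ⁴ whose entries are at least -N.
Quad : Set
Quad = ℕ × ℕ × ℕ × ℕ

quads : ℕ → List Quad
quads m = cartesianProduct (upTo m) (cartesianProduct (upTo m) (cartesianProduct (upTo m) (upTo m)))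

quadSum : Quad → ℕ
quadSum (a , b , c , d) = a ℕ.+ (b ℕ.+ (c ℕ.+ d))

quadWeight : ℕ → Quad → ℕ
quadWeight N (a , b , c , d) = tri a N ℕ.+ (tri b N ℕ.+ (tri c N ℕ.+ tri d N))

-- K is the degree of zᴺ to the fourth power, so the constant term in the colour-wise triple product is
-- the coefficient of zᴷ.
module FrobeniusSeries (R : Ring) (q : CommutativeRing.Carrier R) (n N : ℕ)
  (q^-nil : CommutativeRing._≈_ R (RingKit._^_ R q (suc n)) (CommutativeRing.0# R))
  (2n<N : n ℕ.+ suc n ℕ.≤ N) where

  open RingKit R
  open ListSum R
  open QBinomial R q
  open Nilpotent n q^-nil

  V = palette N
  K = length V

  open Series R K
  open FiniteTripleProduct R q K
  open MonomialSum R K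
  private
    module S = RingKit series
    module SL = ListSum series
    module SP = SubsProduct series

  monomial : ℕ → ℕ → ℕ → Carrier
  monomial a b = X S.^ a · const (q ^ b)

  monomial-* : ∀ a b c d → monomial (a ℕ.+ c) (b ℕ.+ d) S.≈ monomial a b · monomial c d
  monomial-* a b c d = S.begin
    X S.^ (a ℕ.+ c) · const (q ^ (b ℕ.+ d))
      S.≈⟨ S.*-cong {X S.^ (a ℕ.+ c)} {X S.^ a · X S.^ c} (S.^-homo-* X a c) (S.trans (const-cong (^-homo-* q b d)) (const-* (q ^ b) (q ^ d))) ⟩
    X S.^ a · X S.^ c · (const (q ^ b) · const (q ^ d))
      S.≈⟨ S.solve 4 (λ x y z w → x S.:* y S.:* (z S.:* w) S.:= x S.:* z S.:* (y S.:* w)) S.refl (X S.^ a) (X S.^ c) (const (q ^ b)) (const (q ^ d)) ⟩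
    monomial a b · monomial c d  S.∎

  -- The number of columns is charged to the top row, so that an entry l there gives z q^(l+1). In
  -- the bottom row an entry l gives q^l, and an element left out gives z.
  topSum bottomSum : ℕ → Carrier
  topSum    = SL.lsum (λ s → monomial (length s) (length s ℕ.+ value-sum s)) (subs V)
  bottomSum = SL.lsum (λ s → monomial (K ℕ.∸ length s) (value-sum s)) (subs V)

  monomial-0-0 : monomial 0 0 S.≈ S.1#
  monomial-0-0 = S.*-identityˡ (const 1#)

  topSum-≈ : topSum S.≈ upper 1# N S.⁴
  topSum-≈ = S.trans
    (SP.lsum-subs (λ _ s → monomial (length s) (length s ℕ.+ value-sum s)) (λ x → monomial 1 (suc (proj₁ x))) (λ _ → S.1#)
      monomial-0-0
      (λ x xs s _ → S.trans (S.reflexive (cong (monomial (suc (length s))) (exponent (length s) (proj₁ x) (value-sum s))))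
        (monomial-* 1 (suc (proj₁ x)) (length s) (length s ℕ.+ value-sum s)))
      (λ x xs s _ → S.sym (S.*-identityˡ (monomial (length s) (length s ℕ.+ value-sum s)))) V)
    (SP.lprod-palette (λ x → monomial 1 (suc (proj₁ x)) S.+ S.1#) (λ l → linear 1# (1# * q ^ suc l)) (upper 1#)
      (λ l c → factor l) (S.refl {S.1#}) (λ l → S.refl {upper 1# (suc l)}) N)
    where
    exponent : ∀ a v w → suc a ℕ.+ (v ℕ.+ w) ≡ suc v ℕ.+ (a ℕ.+ w)
    exponent a v w = cong suc (≡.trans (≡.sym (ℕ.+-assoc a v w)) (≡.trans (cong (ℕ._+ w) (ℕ.+-comm a v)) (ℕ.+-assoc v a w)))
    factor : ∀ l → (monomial 1 (suc l) S.+ S.1#) S.≈ linear 1# (1# * q ^ suc l)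
    factor l = S.trans (S.+-comm (monomial 1 (suc l)) S.1#) (S.trans
      (S.+-congˡ {S.1#} (S.*-cong {X S.^ 1} {X} (S.*-identityʳ X) (const-cong (sym (*-identityˡ (q ^ suc l))))))
      (S.sym (linear-≈ 1# (1# * q ^ suc l))))

  bottomSum-≈ : bottomSum S.≈ lower N S.⁴
  bottomSum-≈ = S.trans
    (SP.lsum-subs (λ xs s → monomial (length xs ℕ.∸ length s) (value-sum s)) (λ x → monomial 0 (proj₁ x)) (λ _ → monomial 1 0)
      monomial-0-0
      (λ x xs s _ → monomial-* 0 (proj₁ x) (length xs ℕ.∸ length s) (value-sum s))
      -- Dropping x enlarges the complement by one; `s≤xs` is what lets the truncated difference
      -- grow along.
      (λ x xs s s≤xs → S.trans (S.reflexive (cong (λ m → monomial m (value-sum s)) (ℕ.+-∸-assoc 1 s≤xs)))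
        (monomial-* 1 0 (length xs ℕ.∸ length s) (value-sum s))) V)
    (SP.lprod-palette (λ x → monomial 0 (proj₁ x) S.+ monomial 1 0) (λ l → linear (q ^ l) 1#) lower
      (λ l c → factor l) (S.refl {S.1#}) (λ l → S.refl {lower (suc l)}) N)
    where
    factor : ∀ l → (monomial 0 l S.+ monomial 1 0) S.≈ linear (q ^ l) 1#
    factor l = S.trans
      (S.+-cong (S.*-identityˡ (const (q ^ l))) (S.*-congʳ {const 1#} {X S.^ 1} {X} (S.*-identityʳ X)))
      (S.sym (linear-≈ (q ^ l) 1#))

  rowsSum-≈ : SL.lsum (λ r → monomial (charge N r) (rowWeight r)) (allRows N) S.≈ topSum · bottomSum
  rowsSum-≈ = S.trans
    (SL.lsum-cong (All.universal (λ (t , b) →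
      monomial-* (length t) (length t ℕ.+ value-sum t) (K ℕ.∸ length b) (value-sum b)) (allRows N)))
    (SL.lsum-cartesianProduct
      (λ s → monomial (length s) (length s ℕ.+ value-sum s)) (λ s → monomial (K ℕ.∸ length s) (value-sum s)) (subs V) (subs V))

  -- The window of z^N Σ q^(m(m+1)/2) z^m in which k = m + N is at most K.
  theta : ℕ → Carrier
  theta k = q ^ tri k N

  -- The Jacobi triple product in its limiting form: nilpotency of q has absorbed every q-binomial
  -- coefficient.
  theta-product : const (qfac n) · (lower N · upper 1# N) S.≈ theta
  theta-product k k≤K = begin
    (const (qfac n) · (lower N · upper 1# N)) k  ≈⟨ const-· (qfac n) (lower N · upper 1# N) k ⟩
    qfac n * (lower N · upper 1# N) k            ≈⟨ *-congˡ (lower-·-upper-coeff N N k k≤K) ⟩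
    qfac n * (qbin (N ℕ.+ N) k * q ^ tri k N)    ≈⟨ qfac*qbin*q^tri N k 2n<N ⟩
    q ^ tri k N                                  ∎

  theta-as-lsum : theta S.≈ SL.lsum (λ k → monomial k (tri k N)) (upTo (suc K))
  theta-as-lsum k k≤K = sym (series-as-lsum theta (suc K) k (s≤s k≤K))

  theta⁴-as-lsum : theta S.⁴ S.≈ SL.lsum (λ y → monomial (quadSum y) (quadWeight N y)) (quads (suc K))
  theta⁴-as-lsum = S.trans (S.⁴-cong theta-as-lsum) (S.sym (extend quadSum₃ quadWeight₃ (cartesianProduct ks (cartesianProduct ks ks))
    (extend quadSum₂ quadWeight₂ (cartesianProduct ks ks) (extend id (λ k → tri k N) ks (S.refl {SL.lsum (λ k → monomial k (tri k N)) ks})))))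
    where
    ks = upTo (suc K)
    quadSum₂ quadWeight₂ : ℕ × ℕ → ℕ
    quadSum₂ (a , b) = a ℕ.+ b
    quadWeight₂ (a , b) = tri a N ℕ.+ tri b N
    quadSum₃ quadWeight₃ : ℕ × ℕ × ℕ → ℕ
    quadSum₃ (a , b) = a ℕ.+ quadSum₂ b
    quadWeight₃ (a , b) = tri a N ℕ.+ quadWeight₂ b
    extend : {A : Set} (s w : A → ℕ) → ∀ ys {f} → SL.lsum (λ y → monomial (s y) (w y)) ys S.≈ f →
      SL.lsum (λ (k , y) → monomial (k ℕ.+ s y) (tri k N ℕ.+ w y)) (cartesianProduct ks ys)
        S.≈ SL.lsum (λ k → monomial k (tri k N)) ks · f
    extend s w ys e = S.trans
      (SL.lsum-cong (All.universal (λ (k , y) → monomial-* k (tri k N) (s y) (w y)) (cartesianProduct ks ys)))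
      (S.trans (SL.lsum-cartesianProduct (λ k → monomial k (tri k N)) (λ y → monomial (s y) (w y)) ks ys)
               (S.*-congˡ {SL.lsum (λ k → monomial k (tri k N)) ks} e))

  product-identity : const (qfac n ⁴) · SL.lsum (λ r → monomial (charge N r) (rowWeight r)) (allRows N)
    S.≈ SL.lsum (λ y → monomial (quadSum y) (quadWeight N y)) (quads (suc K))
  product-identity = S.begin
    const (qfac n ⁴) · SL.lsum (λ r → monomial (charge N r) (rowWeight r)) (allRows N)
      S.≈⟨ S.*-cong {const (qfac n ⁴)} {E S.⁴} const-⁴ (S.trans rowsSum-≈ (S.*-cong {topSum} topSum-≈ bottomSum-≈)) ⟩
    E S.⁴ · (upper 1# N S.⁴ · lower N S.⁴)
      S.≈⟨ S.solve 3 (λ e u l → p4 e S.:* (p4 u S.:* p4 l) S.:= p4 (e S.:* (l S.:* u))) S.refl E (upper 1# N) (lower N) ⟩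
    (E · (lower N · upper 1# N)) S.⁴
      S.≈⟨ S.⁴-cong theta-product ⟩
    theta S.⁴
      S.≈⟨ theta⁴-as-lsum ⟩
    SL.lsum (λ y → monomial (quadSum y) (quadWeight N y)) (quads (suc K))  S.∎
    where
    E = const (qfac n)
    p4 = λ x → x S.:* (x S.:* (x S.:* x))
    const-⁴ : const (qfac n ⁴) S.≈ E S.⁴
    const-⁴ = S.trans (const-* _ _) (S.*-congˡ {E} (S.trans (const-* _ _) (S.*-congˡ {E} (const-* _ _))))

  frobenius-identity :
    qfac n ⁴ * lsum (λ r → q ^ rowWeight r) (filter (λ r → charge N r ℕ.≟ K) (allRows N))
      ≈ lsum (λ y → q ^ quadWeight N y) (filter (λ y → quadSum y ℕ.≟ K) (quads (suc K)))
  frobenius-identity = begin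
    qfac n ⁴ * lsum (λ r → q ^ rowWeight r) (filter (λ r → charge N r ℕ.≟ K) (allRows N))
      ≈⟨ *-congˡ (lsum-monomials-coeff (charge N) (λ r → q ^ rowWeight r) K (allRows N)) ⟨
    qfac n ⁴ * SL.lsum (λ r → monomial (charge N r) (rowWeight r)) (allRows N) K
      ≈⟨ const-· (qfac n ⁴) _ K ⟨
    (const (qfac n ⁴) · SL.lsum (λ r → monomial (charge N r) (rowWeight r)) (allRows N)) K
      ≈⟨ product-identity K ℕ.≤-refl ⟩
    SL.lsum (λ y → monomial (quadSum y) (quadWeight N y)) (quads (suc K)) K
      ≈⟨ lsum-monomials-coeff quadSum (λ y → q ^ quadWeight N y) K (quads (suc K)) ⟩
    lsum (λ y → q ^ quadWeight N y) (filter (λ y → quadSum y ℕ.≟ K) (quads (suc K)))  ∎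

-- Counting series of weighted sets

ℤ-ring : Ring
ℤ-ring = ℤ.+-*-commutativeRing

sumTo-suc : ∀ n F → sumTo (suc n) F ≡ F 0 ℤ.+ sumTo n (F ∘ suc)
sumTo-suc zero    F = ≡.refl
sumTo-suc (suc n) F = ≡.trans (cong (ℤ._+ F (suc (suc n))) (sumTo-suc n F)) (ℤ.+-assoc (F 0) _ _)

⊛-· : ∀ K f g n → (f ⊛ g) n ≡ Series._·_ ℤ-ring K f g n
⊛-· K f g zero    = ≡.refl
⊛-· K f g (suc n) = ≡.trans (sumTo-suc n _) (cong (λ s → f 0 ℤ.* g (suc n) ℤ.+ s) (⊛-· K (f ∘ suc) g n))

-- Keeping a bijection with each fibre, and not just its size, reduces an identity of series to a
-- weight-preserving bijection of the counted sets.
_counts_by_ : PS → (A : Set) → (A → ℕ) → Set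
S counts A by w = ∀ i → Σ[ c ∈ ℕ ] (+ c ≡ S i) × (Fin c ↔ (Σ[ a ∈ A ] w a ≡ i))

counts-value : ∀ {A : Set} {w : A → ℕ} {S : PS} → S counts A by w →
  ∀ i {c} → Fin c ↔ (Σ[ a ∈ A ] w a ≡ i) → + c ≡ S i
counts-value S# i e with _ , eq , iso ← S# i = ≡.trans (cong +_ (↔⇒≡ (↔-trans e (↔-sym iso)))) eq

counts-unique : ∀ {A B : Set} {w : A → ℕ} {v : B → ℕ} {S S′ : PS} → S counts A by w → S′ counts B by v →
  ∀ i → (Σ[ a ∈ A ] w a ≡ i) ↔ (Σ[ b ∈ B ] v b ≡ i) → S i ≡ S′ i
counts-unique S# S′# i e with _ , eq , iso ← S# i =
  ≡.trans (≡.sym eq) (counts-value S′# i (↔-trans iso e))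

fiber-↔ : ∀ {A B : Set} {w : A → ℕ} {v : B → ℕ} (f : A → B) (g : B → A) →
  (∀ b → f (g b) ≡ b) → (∀ a → g (f a) ≡ a) → (∀ a → v (f a) ≡ w a) →
  ∀ i → (Σ[ a ∈ A ] w a ≡ i) ↔ (Σ[ b ∈ B ] v b ≡ i)
fiber-↔ {v = v} f g fg gf vf i = mk↔ₛ′
  (λ (a , e) → f a , ≡.trans (vf a) e)
  (λ (b , e) → g b , ≡.trans (≡.sym (vf (g b))) (≡.trans (cong v (fg b)) e))
  (λ (b , _) → Σ-≡ (λ _ → ≡-irrelevant) (fg b))
  (λ (a , _) → Σ-≡ (λ _ → ≡-irrelevant) (gf a))

⊎-weight : ∀ {A B : Set} → (A → ℕ) → (B → ℕ) → A ⊎ B → ℕ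
⊎-weight w v (inj₁ a) = w a
⊎-weight w v (inj₂ b) = v b

×-weight : ∀ {A B : Set} → (A → ℕ) → (B → ℕ) → A × B → ℕ
×-weight w v (a , b) = w a ℕ.+ v b

⊕-counts : ∀ {A B : Set} {w : A → ℕ} {v : B → ℕ} {S S′ : PS} → S counts A by w → S′ counts B by v →
  (S ⊕ S′) counts (A ⊎ B) by ⊎-weight w v
⊕-counts S# S′# i with c , eq , iso ← S# i | d , eq′ , iso′ ← S′# i =
  c ℕ.+ d , cong₂ ℤ._+_ eq eq′ , ↔-trans +↔⊎ (↔-trans (iso ⊎-↔ iso′) (mk↔ₛ′
    (λ { (inj₁ (a , e)) → inj₁ a , e ; (inj₂ (b , e)) → inj₂ b , e })
    (λ { (inj₁ a , e) → inj₁ (a , e) ; (inj₂ b , e) → inj₂ (b , e) })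
    (λ { (inj₁ a , e) → ≡.refl ; (inj₂ b , e) → ≡.refl })
    (λ { (inj₁ (a , e)) → ≡.refl ; (inj₂ (b , e)) → ≡.refl })))

conv : (ℕ → ℕ) → (ℕ → ℕ) → ℕ → ℕ
conv c d zero    = c 0 ℕ.* d 0
conv c d (suc i) = c 0 ℕ.* d (suc i) ℕ.+ conv (c ∘ suc) d i

Conv : (ℕ → Set) → (ℕ → Set) → ℕ → Set
Conv F G i = Σ[ j ∈ ℕ ] Σ[ k ∈ ℕ ] (j ℕ.+ k ≡ i) × (F j × G k)

fin-conv : ∀ {F G : ℕ → Set} {c d} → (∀ j → Fin (c j) ↔ F j) → (∀ k → Fin (d k) ↔ G k) →
  ∀ i → Fin (conv c d i) ↔ Conv F G i
fin-conv F↔ G↔ zero = ↔-trans *↔× (↔-trans (F↔ 0 ×-↔ G↔ 0) (mk↔ₛ′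
  (λ p → 0 , 0 , ≡.refl , p) (λ { (zero , zero , ≡.refl , p) → p })
  (λ { (zero , zero , ≡.refl , p) → ≡.refl }) (λ _ → ≡.refl)))
fin-conv {F} {G} F↔ G↔ (suc i) = ↔-trans +↔⊎ (↔-trans
  (↔-trans *↔× (F↔ 0 ×-↔ G↔ (suc i)) ⊎-↔ fin-conv (F↔ ∘ suc) G↔ i) (mk↔ₛ′
    (λ { (inj₁ p) → 0 , suc i , ≡.refl , p ; (inj₂ (j , k , e , p)) → suc j , k , cong suc e , p })
    (λ { (zero , .(suc i) , ≡.refl , p) → inj₁ p ; (suc j , k , ≡.refl , p) → inj₂ (j , k , ≡.refl , p) })
    (λ { (zero , .(suc i) , ≡.refl , p) → ≡.refl ; (suc j , k , ≡.refl , p) → ≡.refl })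
    (λ { (inj₁ p) → ≡.refl ; (inj₂ (j , k , ≡.refl , p)) → ≡.refl })))

conv-⊛ : ∀ {S S′ c d} → (∀ i → + c i ≡ S i) → (∀ i → + d i ≡ S′ i) → ∀ i → + conv c d i ≡ (S ⊛ S′) i
conv-⊛ {S} {S′} e e′ i = ≡.trans (go e i) (≡.sym (⊛-· 0 S S′ i))
  where
  times : ∀ {a b x y} → + a ≡ x → + b ≡ y → + (a ℕ.* b) ≡ x ℤ.* y
  times {a} {b} ≡.refl ≡.refl = ℤ.pos-* a b
  go : ∀ {S c} → (∀ i → + c i ≡ S i) → ∀ i → + conv c _ i ≡ Series._·_ ℤ-ring 0 S S′ i
  go e zero    = times (e 0) (e′ 0)
  go e (suc i) = cong₂ ℤ._+_ (times (e 0) (e′ (suc i))) (go (e ∘ suc) i)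

⊛-counts : ∀ {A B : Set} {w : A → ℕ} {v : B → ℕ} {S S′ : PS} → S counts A by w → S′ counts B by v →
  (S ⊛ S′) counts (A × B) by ×-weight w v
⊛-counts S# S′# i = conv (proj₁ ∘ S#) (proj₁ ∘ S′#) i
  , conv-⊛ (λ j → proj₁ (proj₂ (S# j))) (λ j → proj₁ (proj₂ (S′# j))) i
  , ↔-trans (fin-conv (λ j → proj₂ (proj₂ (S# j))) (λ k → proj₂ (proj₂ (S′# k))) i) (mk↔ₛ′
      (λ { (_ , _ , e , (a , ≡.refl) , (b , ≡.refl)) → (a , b) , e })
      (λ ((a , b) , e) → _ , _ , e , (a , ≡.refl) , (b , ≡.refl))
      (λ _ → ≡.refl)
      (λ { (_ , _ , e , (a , ≡.refl) , (b , ≡.refl)) → ≡.refl }))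

fin0-↔ : ∀ {P : Set} → ¬ P → Fin 0 ↔ P
fin0-↔ ¬p = mk↔ₛ′ (λ ()) (⊥-elim ∘ ¬p) (λ p → ⊥-elim (¬p p)) (λ ())

timesQ-counts : ∀ {A : Set} {w : A → ℕ} {S} → S counts A by w → timesQ S counts A by (suc ∘ w)
timesQ-counts S# zero    = 0 , ≡.refl , fin0-↔ (λ ())
timesQ-counts S# (suc i) with c , eq , iso ← S# i = c , eq , ↔-trans iso (mk↔ₛ′
  (λ (a , e) → a , cong suc e) (λ (a , e) → a , ℕ.suc-injective e)
  (λ _ → Σ-≡ (λ _ → ≡-irrelevant) ≡.refl) (λ _ → Σ-≡ (λ _ → ≡-irrelevant) ≡.refl))

atSquare-counts : ∀ {A : Set} {w : A → ℕ} {S} → S counts A by w → atSquare S counts A by (λ a → w a ℕ.* 2)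
atSquare-counts {w = w} S# i with i ℕ.% 2 in parity
... | suc _ = 0 , ≡.refl , fin0-↔ (λ { (a , ≡.refl) → ℕ.0≢1+n (≡.trans (≡.sym (ℕ.m*n%n≡0 (w a) 2)) parity) })
... | zero with c , eq , iso ← S# (i ℕ./ 2) = c , eq , ↔-trans iso (mk↔ₛ′
  (λ (a , e) → a , ≡.trans (cong (ℕ._* 2) e) (≡.sym i≡))
  (λ (a , e) → a , ≡.trans (≡.sym (ℕ.m*n/n≡m (w a) 2)) (cong (ℕ._/ 2) e))
  (λ _ → Σ-≡ (λ _ → ≡-irrelevant) ≡.refl) (λ _ → Σ-≡ (λ _ → ≡-irrelevant) ≡.refl))
  where
  i≡ : i ≡ i ℕ./ 2 ℕ.* 2
  i≡ = ≡.trans (ℕ.m≡m%n+[m/n]*n i 2) (cong (ℕ._+ i ℕ./ 2 ℕ.* 2) parity)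

sumTo-indicator : ∀ (g : ℕ → ℤ) (p : ℤ → ℤ) x K →
  + length (filter (λ j → p j ℤ.≟ x) (applyUpTo g (suc K))) ≡ sumTo K (λ i → indicator (p (g i)) x)
sumTo-indicator g p x zero    with does (p (g 0) ℤ.≟ x)
... | true  = ≡.refl
... | false = ≡.refl
sumTo-indicator g p x (suc K) = ≡.trans (step (g 0) (applyUpTo (g ∘ suc) (suc K)))
  (≡.trans (cong (λ s → indicator (p (g 0)) x ℤ.+ s) (sumTo-indicator (g ∘ suc) p x K)) (≡.sym (sumTo-suc K _)))
  where
  step : ∀ j js → + length (filter (λ j → p j ℤ.≟ x) (j ∷ js)) ≡ indicator (p j) x ℤ.+ + length (filter (λ j → p j ℤ.≟ x) js)
  step j js with does (p j ℤ.≟ x)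
  ... | true  = ≡.refl
  ... | false = ≡.sym (ℤ.+-identityˡ _)

-- Theta coefficients are indicator sums over a finite window `g 0 , … , g K`; injectivity prevents
-- double counting, and the last hypothesis says that no solution lies outside the window.
indicator-counts : (w : ℤ → ℕ) (p : ℤ → ℤ) → (∀ j → + w j ≡ p j) → ∀ i (g : ℕ → ℤ) K →
  (∀ {a b} → g a ≡ g b → a ≡ b) → (∀ j → w j ≡ i → Σ[ a ∈ ℕ ] (a ℕ.≤ K × g a ≡ j)) →
  Σ[ c ∈ ℕ ] (+ c ≡ sumTo K (λ k → indicator (p (g k)) (+ i))) × (Fin c ↔ (Σ[ j ∈ ℤ ] w j ≡ i))
indicator-counts w p w≡p i g K inj find = _ , sumTo-indicator g p (+ i) K , fin-↔-enumerated (λ _ → ≡-irrelevant)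
  (Unique.filter⁺ (λ j → p j ℤ.≟ + i) (Unique.applyUpTo⁺₁ g (suc K) (λ a<b _ e → ℕ.<⇒≢ a<b (inj e))))
  (λ {j} j∈ → ℤ.+-injective (≡.trans (w≡p j) (proj₂ (∈-filter⁻ (λ j → p j ℤ.≟ + i) {xs = applyUpTo g (suc K)} j∈))))
  (λ {j} e → ∈-filter⁺ (λ j → p j ℤ.≟ + i) (member j (find j e)) (≡.trans (≡.sym (w≡p j)) (cong +_ e)))
  where
  member : ∀ j → Σ[ a ∈ ℕ ] (a ℕ.≤ K × g a ≡ j) → j ∈ applyUpTo g (suc K)
  member j (a , a≤K , ≡.refl) = ∈-applyUpTo⁺ g (s≤s a≤K)

square pronic : ℤ → ℕ
square j = ℤ.∣ j ℤ.* j ∣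
pronic j = ℤ.∣ j ℤ.* (j ℤ.+ + 1) ∣

+square : ∀ j → + square j ≡ j ℤ.* j
+square (+ a)    = ≡.trans (cong (λ z → + ℤ.∣ z ∣) (≡.sym (ℤ.pos-* a a))) (ℤ.pos-* a a)
+square -[1+ a ] = ≡.refl

-- A product of two consecutive integers is never negative. At j = -1 the second factor is 0; below
-- that both factors are negative.
+pronic : ∀ j → + pronic j ≡ j ℤ.* (j ℤ.+ + 1)
+pronic (+ a)          = ≡.trans (cong (λ z → + ℤ.∣ z ∣) (≡.sym (ℤ.pos-* a (a ℕ.+ 1)))) (ℤ.pos-* a (a ℕ.+ 1))
+pronic -[1+ zero ]    = ≡.refl
+pronic -[1+ (suc a) ] = ≡.refl

+-minus-injective : ∀ m {a b} → + a ℤ.- + m ≡ + b ℤ.- + m → a ≡ b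
+-minus-injective m {a} {b} e = ℤ.+-injective (≡.trans (≡.sym (cancel (+ a) (+ m))) (≡.trans (cong (ℤ._+ + m) e) (cancel (+ b) (+ m))))
  where
  cancel : ∀ x y → x ℤ.- y ℤ.+ y ≡ x
  cancel = ℤ-Solver.solve-∀

theta3-counts : theta3 counts ℤ by square
theta3-counts i = indicator-counts square (λ j → j ℤ.* j) +square i (λ a → + a ℤ.- + i) (2 ℕ.* i) (+-minus-injective i) find
  where
  n≤n² : ∀ n → n ℕ.≤ n ℕ.* n
  n≤n² zero    = z≤n
  n≤n² (suc n) = ℕ.m≤m*n (suc n) (suc n)
  add-sub : ∀ x y → x ℤ.+ y ℤ.- y ≡ x
  add-sub = ℤ-Solver.solve-∀
  sub-neg : ∀ x y → x ℤ.- y ℤ.- x ≡ ℤ.- y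
  sub-neg = ℤ-Solver.solve-∀
  find : ∀ j → square j ≡ i → Σ[ a ∈ ℕ ] (a ℕ.≤ 2 ℕ.* i × + a ℤ.- + i ≡ j)
  find (+ m) e = m ℕ.+ i , ℕ.+-mono-≤ m≤i (ℕ.m≤m+n i 0) , add-sub (+ m) (+ i)
    where
    m≤i : m ℕ.≤ i
    m≤i = ℕ.≤-trans (n≤n² m) (ℕ.≤-reflexive (≡.trans (ℤ.+-injective (≡.trans (ℤ.pos-* m m) (≡.sym (+square (+ m))))) e))
  find -[1+ m ] e = i ℕ.∸ suc m , ℕ.≤-trans (ℕ.m∸n≤m i (suc m)) (ℕ.m≤m+n i _)
    , ≡.trans (cong (ℤ._- + i) (≡.sym (ℤ.⊖-≥ m<i))) (≡.trans (cong (ℤ._- + i) (≡.sym (ℤ.m-n≡m⊖n i (suc m)))) (sub-neg (+ i) (+ suc m)))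
    where
    m<i : suc m ℕ.≤ i
    m<i = ℕ.≤-trans (n≤n² (suc m)) (ℕ.≤-reflexive e)

-- The window -i-1 ≤ j ≤ i suffices because j = m and j = -1 - m both give m (m + 1), which is at
-- least m.
thetaT-counts : thetaT counts ℤ by pronic
thetaT-counts i = indicator-counts pronic (λ j → j ℤ.* (j ℤ.+ + 1)) +pronic i (λ a → + a ℤ.- + suc i) (2 ℕ.* i ℕ.+ 1)
  (+-minus-injective (suc i)) find
  where
  add-sub : ∀ x y → x ℤ.+ y ℤ.- y ≡ x
  add-sub = ℤ-Solver.solve-∀
  sub-suc : ∀ x y → x ℤ.- y ℤ.- (+ 1 ℤ.+ x) ≡ ℤ.- (+ 1 ℤ.+ y)
  sub-suc = ℤ-Solver.solve-∀
  bound : ∀ m → m ℕ.≤ i → m ℕ.+ suc i ℕ.≤ 2 ℕ.* i ℕ.+ 1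
  bound m m≤i = ℕ.≤-trans (ℕ.+-monoˡ-≤ (suc i) m≤i) (ℕ.≤-reflexive
    (≡.trans (ℕ.+-suc i i) (≡.trans (ℕ.+-comm 1 (i ℕ.+ i)) (cong (λ x → i ℕ.+ x ℕ.+ 1) (≡.sym (ℕ.+-identityʳ i))))))
  find : ∀ j → pronic j ≡ i → Σ[ a ∈ ℕ ] (a ℕ.≤ 2 ℕ.* i ℕ.+ 1 × + a ℤ.- + suc i ≡ j)
  find (+ m) e = m ℕ.+ suc i , bound m m≤i , add-sub (+ m) (+ suc i)
    where
    m≤m[m+1] : ∀ m → m ℕ.≤ m ℕ.* (m ℕ.+ 1)
    m≤m[m+1] m = ℕ.≤-trans (ℕ.≤-reflexive (≡.sym (ℕ.*-identityʳ m))) (ℕ.*-monoʳ-≤ m (ℕ.m≤n+m 1 m))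
    m≤i : m ℕ.≤ i
    m≤i = ℕ.≤-trans (m≤m[m+1] m) (ℕ.≤-reflexive
      (≡.trans (ℤ.+-injective (≡.trans (ℤ.pos-* m (m ℕ.+ 1)) (≡.sym (+pronic (+ m))))) e))
  find -[1+ m ] e = i ℕ.∸ m , ℕ.≤-trans (ℕ.m∸n≤m i m) (ℕ.≤-trans (ℕ.m≤n+m i 0) (ℕ.≤-trans (ℕ.n≤1+n i) (bound 0 z≤n)))
    , ≡.trans (cong (ℤ._- + suc i) (≡.sym (ℤ.⊖-≥ (m≤i m e)))) (≡.trans (cong (ℤ._- + suc i) (≡.sym (ℤ.m-n≡m⊖n i m))) (sub-suc (+ i) (+ m)))
    where
    m≤i : ∀ m → pronic -[1+ m ] ≡ i → m ℕ.≤ i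
    m≤i zero    _      = z≤n
    m≤i (suc m) ≡.refl = ℕ.m≤n*m (suc m) (suc (suc m))

-- Parity splittings of ℤ² and of the lattice A₃

-- Division by 2 read backwards: the tag is the remainder, and `half` is the inverse.
double : ℤ ⊎ ℤ → ℤ
double (inj₁ x) = + 2 ℤ.* x
double (inj₂ x) = + 2 ℤ.* x ℤ.+ + 1

even≢odd : ∀ x y → + 2 ℤ.* x ≢ + 2 ℤ.* y ℤ.+ + 1
even≢odd x y e = 2n≢1 ℤ.∣ x ℤ.- y ∣ (≡.trans (≡.sym (ℤ.abs-* (+ 2) (x ℤ.- y)))
  (cong ℤ.∣_∣ (≡.trans (expand x y) (≡.trans (cong (ℤ._- + 2 ℤ.* y) e) (cancel (+ 2 ℤ.* y))))))
  where
  expand : ∀ x y → + 2 ℤ.* (x ℤ.- y) ≡ + 2 ℤ.* x ℤ.- + 2 ℤ.* y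
  expand = ℤ-Solver.solve-∀
  cancel : ∀ z → z ℤ.+ + 1 ℤ.- z ≡ + 1
  cancel = ℤ-Solver.solve-∀
  2n≢1 : ∀ n → 2 ℕ.* n ≢ 1
  2n≢1 (suc n) e with () ← ≡.trans (≡.sym (ℕ.*-suc 2 n)) e

double-injective : ∀ s t → double s ≡ double t → s ≡ t
double-injective (inj₁ x) (inj₁ y) e = cong inj₁ (ℤ.*-cancelˡ-≡ (+ 2) x y e)
double-injective (inj₁ x) (inj₂ y) e = ⊥-elim (even≢odd x y e)
double-injective (inj₂ x) (inj₁ y) e = ⊥-elim (even≢odd y x (≡.sym e))
double-injective (inj₂ x) (inj₂ y) e = cong inj₂ (ℤ.*-cancelˡ-≡ (+ 2) x y (RingKit.+-cancelʳ ℤ-ring (+ 1) _ _ e))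

halve : ∀ a → Σ[ s ∈ ℤ ⊎ ℤ ] double s ≡ a
halve a with a ℤ.%ℕ 2 | ℤ.n%ℕd<d a 2 | ℤ.a≡a%ℕn+[a/ℕn]*n a 2
... | 0 | _ | e = inj₁ (a ℤ./ℕ 2) , ≡.sym (≡.trans e (≡.trans (ℤ.+-identityˡ _) (ℤ.*-comm (a ℤ./ℕ 2) (+ 2))))
... | 1 | _ | e = inj₂ (a ℤ./ℕ 2) , ≡.sym (≡.trans e (≡.trans (ℤ.+-comm (+ 1) (a ℤ./ℕ 2 ℤ.* + 2)) (cong (ℤ._+ + 1) (ℤ.*-comm (a ℤ./ℕ 2) (+ 2)))))
... | suc (suc _) | s≤s (s≤s ()) | _

half : ℤ → ℤ ⊎ ℤ
half a = proj₁ (halve a)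

double-half : ∀ a → double (half a) ≡ a
double-half a = proj₂ (halve a)

half-double : ∀ s {a} → a ≡ double s → half a ≡ s
half-double s ≡.refl = double-injective _ s (double-half (double s))

ℤ² ℤ³ : Set
ℤ² = ℤ × ℤ
ℤ³ = ℤ × ℤ²

+*2 : ∀ {w z} → + w ≡ z → + (w ℕ.* 2) ≡ z ℤ.* + 2
+*2 {w} ≡.refl = ℤ.pos-* w 2

evenWeight : ℤ → ℕ
evenWeight x = square x ℕ.* 2

-- Half of (2x + 1)² + (2y + 1)², just as `evenWeight x` is half of (2x)².
oddWeight : ℤ² → ℕ
oddWeight p = suc (×-weight pronic pronic p ℕ.* 2)

+evenWeight : ∀ x → + evenWeight x ≡ x ℤ.* x ℤ.* + 2
+evenWeight x = +*2 (+square x)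

+oddWeight : ∀ x y → + oddWeight (x , y) ≡ + 1 ℤ.+ (x ℤ.* (x ℤ.+ + 1) ℤ.+ y ℤ.* (y ℤ.+ + 1)) ℤ.* + 2
+oddWeight x y = cong (λ z → + 1 ℤ.+ z) (+*2 {×-weight pronic pronic (x , y)} (cong₂ ℤ._+_ (+pronic x) (+pronic y)))

θ² : PS
θ² = atSquare theta3

θ²-counts : θ² counts ℤ by evenWeight
θ²-counts = atSquare-counts theta3-counts

theta2sq-counts : theta2sq-q2 counts ℤ² by oddWeight
theta2sq-counts = timesQ-counts (atSquare-counts (⊛-counts thetaT-counts thetaT-counts))

-- Σ x² over ℤ², split by the parity of x + y: (x , y) = (u + v , u − v) or (u + v + 1 , u − v).
theta3² : ∀ i → (theta3 ⊛ theta3) i ≡ ((θ² ⊛ θ²) ⊕ theta2sq-q2) i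
theta3² i = counts-unique (⊛-counts theta3-counts theta3-counts) (⊕-counts (⊛-counts θ²-counts θ²-counts) theta2sq-counts) i
  (↔-sym (fiber-↔ f g fg gf weight i))
  where
  f : ℤ² ⊎ ℤ² → ℤ²
  f (inj₁ (u , v)) = u ℤ.+ v , u ℤ.- v
  f (inj₂ (u , v)) = u ℤ.+ v ℤ.+ + 1 , u ℤ.- v
  unhalve : ℤ → ℤ ⊎ ℤ → ℤ² ⊎ ℤ²
  unhalve y (inj₁ u) = inj₁ (u , u ℤ.- y)
  unhalve y (inj₂ u) = inj₂ (u , u ℤ.- y)
  g : ℤ² → ℤ² ⊎ ℤ²
  g (x , y) = unhalve y (half (x ℤ.+ y))
  reflect : ∀ u v → u ℤ.- (u ℤ.- v) ≡ v
  reflect = ℤ-Solver.solve-∀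
  f-unhalve : ∀ y s → f (unhalve y s) ≡ (double s ℤ.- y , y)
  f-unhalve y (inj₁ u) = cong₂ _,_ (e u y) (reflect u y)
    where
    e : ∀ u y → u ℤ.+ (u ℤ.- y) ≡ + 2 ℤ.* u ℤ.- y
    e = ℤ-Solver.solve-∀
  f-unhalve y (inj₂ u) = cong₂ _,_ (e u y) (reflect u y)
    where
    e : ∀ u y → u ℤ.+ (u ℤ.- y) ℤ.+ + 1 ≡ + 2 ℤ.* u ℤ.+ + 1 ℤ.- y
    e = ℤ-Solver.solve-∀
  fg : ∀ p → f (g p) ≡ p
  fg (x , y) = ≡.trans (f-unhalve y (half (x ℤ.+ y)))
    (cong (_, y) (≡.trans (cong (ℤ._- y) (double-half (x ℤ.+ y))) (add-sub x y)))
    where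
    add-sub : ∀ x y → x ℤ.+ y ℤ.- y ≡ x
    add-sub = ℤ-Solver.solve-∀
  gf : ∀ p → g (f p) ≡ p
  gf (inj₁ (u , v)) = ≡.trans (cong (unhalve (u ℤ.- v)) (half-double (inj₁ u) (e u v))) (cong (λ z → inj₁ (u , z)) (reflect u v))
    where
    e : ∀ u v → u ℤ.+ v ℤ.+ (u ℤ.- v) ≡ + 2 ℤ.* u
    e = ℤ-Solver.solve-∀
  gf (inj₂ (u , v)) = ≡.trans (cong (unhalve (u ℤ.- v)) (half-double (inj₂ u) (e u v))) (cong (λ z → inj₂ (u , z)) (reflect u v))
    where
    e : ∀ u v → u ℤ.+ v ℤ.+ + 1 ℤ.+ (u ℤ.- v) ≡ + 2 ℤ.* u ℤ.+ + 1
    e = ℤ-Solver.solve-∀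
  weight : ∀ p → ×-weight square square (f p) ≡ ⊎-weight (×-weight evenWeight evenWeight) oddWeight p
  weight (inj₁ (u , v)) = ℤ.+-injective (≡.trans (cong₂ ℤ._+_ (+square (u ℤ.+ v)) (+square (u ℤ.- v)))
    (≡.trans (e u v) (≡.sym (cong₂ ℤ._+_ (+evenWeight u) (+evenWeight v)))))
    where
    e : ∀ u v → (u ℤ.+ v) ℤ.* (u ℤ.+ v) ℤ.+ (u ℤ.- v) ℤ.* (u ℤ.- v) ≡ u ℤ.* u ℤ.* + 2 ℤ.+ v ℤ.* v ℤ.* + 2
    e = ℤ-Solver.solve-∀
  weight (inj₂ (u , v)) = ℤ.+-injective (≡.trans (cong₂ ℤ._+_ (+square (u ℤ.+ v ℤ.+ + 1)) (+square (u ℤ.- v)))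
    (≡.trans (e u v) (≡.sym (+oddWeight u v))))
    where
    e : ∀ u v → (u ℤ.+ v ℤ.+ + 1) ℤ.* (u ℤ.+ v ℤ.+ + 1) ℤ.+ (u ℤ.- v) ℤ.* (u ℤ.- v)
      ≡ + 1 ℤ.+ (u ℤ.* (u ℤ.+ + 1) ℤ.+ v ℤ.* (v ℤ.+ + 1)) ℤ.* + 2
    e = ℤ-Solver.solve-∀

-- The lattice {m ∈ ℤ⁴ : Σ m = 0} in the coordinates a = m₁ + m₂, b = m₁ + m₃, m = m₁.
lattice : ℤ³ → ℤ × ℤ³
lattice (a , b , m) = m , a ℤ.- m , b ℤ.- m , m ℤ.- a ℤ.- b

norm : ℤ × ℤ³ → ℕ
norm (m₁ , m₂ , m₃ , m₄) = square m₁ ℕ.+ (square m₂ ℕ.+ (square m₃ ℕ.+ square m₄))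

+norm : ∀ m₁ m₂ m₃ m₄ → + norm (m₁ , m₂ , m₃ , m₄) ≡ m₁ ℤ.* m₁ ℤ.+ (m₂ ℤ.* m₂ ℤ.+ (m₃ ℤ.* m₃ ℤ.+ m₄ ℤ.* m₄))
+norm m₁ m₂ m₃ m₄ = cong₂ ℤ._+_ (+square m₁) (cong₂ ℤ._+_ (+square m₂) (cong₂ ℤ._+_ (+square m₃) (+square m₄)))

-- The exponent of q is half the norm; doubling i avoids the division.
LatticePoint : ℕ → Set
LatticePoint i = Σ[ p ∈ ℤ³ ] norm (lattice p) ≡ i ℕ.* 2

Split : Set
Split = ℤ³ ⊎ (ℤ³ ⊎ (ℤ³ ⊎ ℤ³))

mixedWeight splitEven : ℤ³ → ℕ
mixedWeight = ×-weight evenWeight oddWeight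
splitEven = ×-weight evenWeight (×-weight evenWeight evenWeight)

splitWeight : Split → ℕ
splitWeight = ⊎-weight splitEven (⊎-weight mixedWeight (⊎-weight mixedWeight mixedWeight))

A₃-theta : PS
A₃-theta = (θ² ⊛ (θ² ⊛ θ²)) ⊕ ((θ² ⊛ theta2sq-q2) ⊕ ((θ² ⊛ theta2sq-q2) ⊕ (θ² ⊛ theta2sq-q2)))

A₃-theta-counts : A₃-theta counts Split by splitWeight
A₃-theta-counts = ⊕-counts (⊛-counts θ²-counts (⊛-counts θ²-counts θ²-counts)) (⊕-counts mixed (⊕-counts mixed mixed))
  where
  mixed = ⊛-counts θ²-counts theta2sq-counts

-- With c = m₁ + m₄ the norm is a² + b² + c² and a + b + c = 2 m₁ is even, so either a, b, c are
-- all even or exactly one of them is.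
split-↔-lattice : ∀ i → (Σ[ s ∈ Split ] splitWeight s ≡ i) ↔ LatticePoint i
split-↔-lattice i = mk↔ₛ′
  (λ (s , e) → f s , ≡.trans (weight s) (cong (ℕ._* 2) e))
  (λ (p , e) → g p , ℕ.*-cancelʳ-≡ _ i 2 (≡.trans (≡.sym (weight (g p))) (≡.trans (cong (norm ∘ lattice) (fg p)) e)))
  (λ (p , _) → Σ-≡ (λ _ → ≡-irrelevant) (fg p))
  (λ (s , _) → Σ-≡ (λ _ → ≡-irrelevant) (gf s))
  where
  f : Split → ℤ³
  -- The third coordinate is m₁ = (a + b + c) / 2, where c is 2w or 2w + 1; two odd entries account
  -- for the extra 1. In the mixed summands the half of the even entry is stored in front, where
  -- `mixedWeight` expects it.
  f (inj₁ (x , y , w))               = double (inj₁ x) , double (inj₁ y) , x ℤ.+ y ℤ.+ w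
  f (inj₂ (inj₁ (x , y , w)))        = double (inj₁ x) , double (inj₂ y) , x ℤ.+ y ℤ.+ + 1 ℤ.+ w
  f (inj₂ (inj₂ (inj₁ (y , x , w)))) = double (inj₂ x) , double (inj₁ y) , x ℤ.+ y ℤ.+ + 1 ℤ.+ w
  f (inj₂ (inj₂ (inj₂ (w , x , y)))) = double (inj₂ x) , double (inj₂ y) , x ℤ.+ y ℤ.+ + 1 ℤ.+ w
  -- The parities of a and b determine that of c, since the three have an even sum; m then fixes the
  -- half of c.
  classify : ℤ → ℤ ⊎ ℤ → ℤ ⊎ ℤ → Split
  classify m (inj₁ x) (inj₁ y) = inj₁ (x , y , m ℤ.- (x ℤ.+ y))
  classify m (inj₁ x) (inj₂ y) = inj₂ (inj₁ (x , y , m ℤ.- (x ℤ.+ y ℤ.+ + 1)))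
  classify m (inj₂ x) (inj₁ y) = inj₂ (inj₂ (inj₁ (y , x , m ℤ.- (x ℤ.+ y ℤ.+ + 1))))
  classify m (inj₂ x) (inj₂ y) = inj₂ (inj₂ (inj₂ (m ℤ.- (x ℤ.+ y ℤ.+ + 1) , x , y)))
  g : ℤ³ → Split
  g (a , b , m) = classify m (half a) (half b)
  add-minus : ∀ m z → z ℤ.+ (m ℤ.- z) ≡ m
  add-minus = ℤ-Solver.solve-∀
  minus-add : ∀ m z → z ℤ.+ m ℤ.- z ≡ m
  minus-add = ℤ-Solver.solve-∀
  f-classify : ∀ m s t → f (classify m s t) ≡ (double s , double t , m)
  f-classify m (inj₁ x) (inj₁ y) = cong (λ z → _ , _ , z) (add-minus m (x ℤ.+ y))
  f-classify m (inj₁ x) (inj₂ y) = cong (λ z → _ , _ , z) (add-minus m (x ℤ.+ y ℤ.+ + 1))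
  f-classify m (inj₂ x) (inj₁ y) = cong (λ z → _ , _ , z) (add-minus m (x ℤ.+ y ℤ.+ + 1))
  f-classify m (inj₂ x) (inj₂ y) = cong (λ z → _ , _ , z) (add-minus m (x ℤ.+ y ℤ.+ + 1))
  fg : ∀ p → f (g p) ≡ p
  fg (a , b , m) = ≡.trans (f-classify m (half a) (half b)) (cong₂ (λ a b → a , b , m) (double-half a) (double-half b))
  g-double : ∀ s t m → g (double s , double t , m) ≡ classify m s t
  g-double s t m = cong₂ (classify m) (half-double s ≡.refl) (half-double t ≡.refl)
  gf : ∀ s → g (f s) ≡ s
  gf (inj₁ (x , y , w)) = ≡.trans (g-double (inj₁ x) (inj₁ y) _) (cong (λ z → inj₁ (x , y , z)) (minus-add w (x ℤ.+ y)))
  gf (inj₂ (inj₁ (x , y , w))) = ≡.trans (g-double (inj₁ x) (inj₂ y) _) (cong (λ z → inj₂ (inj₁ (x , y , z))) (minus-add w (x ℤ.+ y ℤ.+ + 1)))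
  gf (inj₂ (inj₂ (inj₁ (y , x , w)))) = ≡.trans (g-double (inj₂ x) (inj₁ y) _) (cong (λ z → inj₂ (inj₂ (inj₁ (y , x , z)))) (minus-add w (x ℤ.+ y ℤ.+ + 1)))
  gf (inj₂ (inj₂ (inj₂ (w , x , y)))) = ≡.trans (g-double (inj₂ x) (inj₂ y) _) (cong (λ z → inj₂ (inj₂ (inj₂ (z , x , y)))) (minus-add w (x ℤ.+ y ℤ.+ + 1)))
  +lattice : ∀ a b m → + norm (lattice (a , b , m))
    ≡ m ℤ.* m ℤ.+ ((a ℤ.- m) ℤ.* (a ℤ.- m) ℤ.+ ((b ℤ.- m) ℤ.* (b ℤ.- m) ℤ.+ (m ℤ.- a ℤ.- b) ℤ.* (m ℤ.- a ℤ.- b)))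
  +lattice a b m = +norm m (a ℤ.- m) (b ℤ.- m) (m ℤ.- a ℤ.- b)
  three-squares : ∀ a b c m → a ℤ.+ b ℤ.+ c ≡ + 2 ℤ.* m →
    m ℤ.* m ℤ.+ ((a ℤ.- m) ℤ.* (a ℤ.- m) ℤ.+ ((b ℤ.- m) ℤ.* (b ℤ.- m) ℤ.+ (m ℤ.- a ℤ.- b) ℤ.* (m ℤ.- a ℤ.- b)))
      ≡ a ℤ.* a ℤ.+ b ℤ.* b ℤ.+ c ℤ.* c
  three-squares a b c m e = ≡.trans (expand a b m) (cong (λ c → a ℤ.* a ℤ.+ b ℤ.* b ℤ.+ c ℤ.* c) (≡.sym c≡))
    where
    expand : ∀ a b m → m ℤ.* m ℤ.+ ((a ℤ.- m) ℤ.* (a ℤ.- m) ℤ.+ ((b ℤ.- m) ℤ.* (b ℤ.- m) ℤ.+ (m ℤ.- a ℤ.- b) ℤ.* (m ℤ.- a ℤ.- b)))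
      ≡ a ℤ.* a ℤ.+ b ℤ.* b ℤ.+ (+ 2 ℤ.* m ℤ.- (a ℤ.+ b)) ℤ.* (+ 2 ℤ.* m ℤ.- (a ℤ.+ b))
    expand = ℤ-Solver.solve-∀
    c≡ : c ≡ + 2 ℤ.* m ℤ.- (a ℤ.+ b)
    c≡ = ≡.trans (≡.sym (minus-add c (a ℤ.+ b))) (cong (ℤ._- (a ℤ.+ b)) e)
  weight-via : ∀ a b c m {w z} → + w ≡ z → a ℤ.+ b ℤ.+ c ≡ + 2 ℤ.* m → a ℤ.* a ℤ.+ b ℤ.* b ℤ.+ c ℤ.* c ≡ z ℤ.* + 2 →
    norm (lattice (a , b , m)) ≡ w ℕ.* 2
  weight-via a b c m w≡z s e = ℤ.+-injective (≡.trans (+lattice a b m) (≡.trans (three-squares a b c m s) (≡.trans e (≡.sym (+*2 w≡z)))))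
  weight : ∀ s → norm (lattice (f s)) ≡ splitWeight s ℕ.* 2
  weight (inj₁ (x , y , w)) = weight-via (+ 2 ℤ.* x) (+ 2 ℤ.* y) (+ 2 ℤ.* w) _ {splitEven (x , y , w)}
    (cong₂ ℤ._+_ (+evenWeight x) (cong₂ ℤ._+_ (+evenWeight y) (+evenWeight w))) (s x y w) (e x y w)
    where
    s : ∀ x y w → + 2 ℤ.* x ℤ.+ + 2 ℤ.* y ℤ.+ + 2 ℤ.* w ≡ + 2 ℤ.* (x ℤ.+ y ℤ.+ w)
    s = ℤ-Solver.solve-∀
    e : ∀ x y w → + 2 ℤ.* x ℤ.* (+ 2 ℤ.* x) ℤ.+ + 2 ℤ.* y ℤ.* (+ 2 ℤ.* y) ℤ.+ + 2 ℤ.* w ℤ.* (+ 2 ℤ.* w)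
      ≡ (x ℤ.* x ℤ.* + 2 ℤ.+ (y ℤ.* y ℤ.* + 2 ℤ.+ w ℤ.* w ℤ.* + 2)) ℤ.* + 2
    e = ℤ-Solver.solve-∀
  weight (inj₂ (inj₁ (x , y , w))) = weight-via (+ 2 ℤ.* x) (+ 2 ℤ.* y ℤ.+ + 1) (+ 2 ℤ.* w ℤ.+ + 1) _ {mixedWeight (x , y , w)}
    (cong₂ ℤ._+_ (+evenWeight x) (+oddWeight y w)) (s x y w) (e x y w)
    where
    s : ∀ x y w → + 2 ℤ.* x ℤ.+ (+ 2 ℤ.* y ℤ.+ + 1) ℤ.+ (+ 2 ℤ.* w ℤ.+ + 1) ≡ + 2 ℤ.* (x ℤ.+ y ℤ.+ + 1 ℤ.+ w)
    s = ℤ-Solver.solve-∀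
    e : ∀ x y w → + 2 ℤ.* x ℤ.* (+ 2 ℤ.* x) ℤ.+ (+ 2 ℤ.* y ℤ.+ + 1) ℤ.* (+ 2 ℤ.* y ℤ.+ + 1) ℤ.+ (+ 2 ℤ.* w ℤ.+ + 1) ℤ.* (+ 2 ℤ.* w ℤ.+ + 1)
      ≡ (x ℤ.* x ℤ.* + 2 ℤ.+ (+ 1 ℤ.+ (y ℤ.* (y ℤ.+ + 1) ℤ.+ w ℤ.* (w ℤ.+ + 1)) ℤ.* + 2)) ℤ.* + 2
    e = ℤ-Solver.solve-∀
  weight (inj₂ (inj₂ (inj₁ (y , x , w)))) = weight-via (+ 2 ℤ.* x ℤ.+ + 1) (+ 2 ℤ.* y) (+ 2 ℤ.* w ℤ.+ + 1) _ {mixedWeight (y , x , w)}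
    (cong₂ ℤ._+_ (+evenWeight y) (+oddWeight x w)) (s x y w) (e x y w)
    where
    s : ∀ x y w → + 2 ℤ.* x ℤ.+ + 1 ℤ.+ + 2 ℤ.* y ℤ.+ (+ 2 ℤ.* w ℤ.+ + 1) ≡ + 2 ℤ.* (x ℤ.+ y ℤ.+ + 1 ℤ.+ w)
    s = ℤ-Solver.solve-∀
    e : ∀ x y w → (+ 2 ℤ.* x ℤ.+ + 1) ℤ.* (+ 2 ℤ.* x ℤ.+ + 1) ℤ.+ + 2 ℤ.* y ℤ.* (+ 2 ℤ.* y) ℤ.+ (+ 2 ℤ.* w ℤ.+ + 1) ℤ.* (+ 2 ℤ.* w ℤ.+ + 1)
      ≡ (y ℤ.* y ℤ.* + 2 ℤ.+ (+ 1 ℤ.+ (x ℤ.* (x ℤ.+ + 1) ℤ.+ w ℤ.* (w ℤ.+ + 1)) ℤ.* + 2)) ℤ.* + 2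
    e = ℤ-Solver.solve-∀
  weight (inj₂ (inj₂ (inj₂ (w , x , y)))) = weight-via (+ 2 ℤ.* x ℤ.+ + 1) (+ 2 ℤ.* y ℤ.+ + 1) (+ 2 ℤ.* w) _ {mixedWeight (w , x , y)}
    (cong₂ ℤ._+_ (+evenWeight w) (+oddWeight x y)) (s x y w) (e x y w)
    where
    s : ∀ x y w → + 2 ℤ.* x ℤ.+ + 1 ℤ.+ (+ 2 ℤ.* y ℤ.+ + 1) ℤ.+ + 2 ℤ.* w ≡ + 2 ℤ.* (x ℤ.+ y ℤ.+ + 1 ℤ.+ w)
    s = ℤ-Solver.solve-∀
    e : ∀ x y w → (+ 2 ℤ.* x ℤ.+ + 1) ℤ.* (+ 2 ℤ.* x ℤ.+ + 1) ℤ.+ (+ 2 ℤ.* y ℤ.+ + 1) ℤ.* (+ 2 ℤ.* y ℤ.+ + 1) ℤ.+ + 2 ℤ.* w ℤ.* (+ 2 ℤ.* w)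
      ≡ (w ℤ.* w ℤ.* + 2 ℤ.+ (+ 1 ℤ.+ (x ℤ.* (x ℤ.+ + 1) ℤ.+ y ℤ.* (y ℤ.+ + 1)) ℤ.* + 2)) ℤ.* + 2
    e = ℤ-Solver.solve-∀

-- Balanced quadruples and lattice vectors of bounded norm.

+tri : ∀ k b → + (tri k b ℕ.* 2) ≡ (+ k ℤ.- + b) ℤ.* (+ k ℤ.- + b ℤ.+ + 1)
+tri k b = ≡.trans (ℤ.pos-* (tri k b) 2) (go k b)
  where
  +triangle : ∀ n → + triangle n ℤ.* + 2 ≡ + n ℤ.* (+ n ℤ.+ + 1)
  +triangle zero    = ≡.refl
  +triangle (suc n) = ≡.trans (ℤ.*-distribʳ-+ (+ 2) (+ suc n) (+ triangle n))
    (≡.trans (cong (λ z → + suc n ℤ.* + 2 ℤ.+ z) (+triangle n)) (step (+ n)))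
    where
    step : ∀ x → (+ 1 ℤ.+ x) ℤ.* + 2 ℤ.+ x ℤ.* (x ℤ.+ + 1) ≡ (+ 1 ℤ.+ x) ℤ.* (+ 1 ℤ.+ x ℤ.+ + 1)
    step = ℤ-Solver.solve-∀
  go : ∀ k b → + tri k b ℤ.* + 2 ≡ (+ k ℤ.- + b) ℤ.* (+ k ℤ.- + b ℤ.+ + 1)
  go k       zero    = ≡.trans (+triangle k) (e (+ k))
    where
    e : ∀ x → x ℤ.* (x ℤ.+ + 1) ≡ (x ℤ.- + 0) ℤ.* (x ℤ.- + 0 ℤ.+ + 1)
    e = ℤ-Solver.solve-∀
  go zero    (suc b) = ≡.trans (+triangle b) (e (+ b))
    where
    e : ∀ x → x ℤ.* (x ℤ.+ + 1) ≡ (+ 0 ℤ.- (+ 1 ℤ.+ x)) ℤ.* (+ 0 ℤ.- (+ 1 ℤ.+ x) ℤ.+ + 1)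
    e = ℤ-Solver.solve-∀
  go (suc k) (suc b) = ≡.trans (go k b) (e (+ k) (+ b))
    where
    e : ∀ x y → (x ℤ.- y) ℤ.* (x ℤ.- y ℤ.+ + 1) ≡ (+ 1 ℤ.+ x ℤ.- (+ 1 ℤ.+ y)) ℤ.* (+ 1 ℤ.+ x ℤ.- (+ 1 ℤ.+ y) ℤ.+ + 1)
    e = ℤ-Solver.solve-∀

BalancedQuad : ℕ → ℕ → Set
BalancedQuad N i = Σ[ y ∈ Quad ] (quadSum y ≡ 4 ℕ.* N) × (quadWeight N y ≡ i)

module _ (N : ℕ) where

  offset : ℕ → ℤ
  offset k = + k ℤ.- + N

  position : ℤ → ℕ
  position m = ℤ.∣ m ℤ.+ + N ∣

  offsets : Quad → ℤ × ℤ³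
  offsets (a , b , c , d) = offset a , offset b , offset c , offset d

  positions : ℤ × ℤ³ → Quad
  positions (a , b , c , d) = position a , position b , position c , position d

  coordinates : ℤ × ℤ³ → ℤ³
  coordinates (m₁ , m₂ , m₃ , _) = m₁ ℤ.+ m₂ , m₁ ℤ.+ m₃ , m₁

  total : ℤ × ℤ³ → ℤ
  total (m₁ , m₂ , m₃ , m₄) = m₁ ℤ.+ (m₂ ℤ.+ (m₃ ℤ.+ m₄))

  position-offset : ∀ k → position (offset k) ≡ k
  position-offset k = cong ℤ.∣_∣ (e (+ k) (+ N))
    where
    e : ∀ x y → x ℤ.- y ℤ.+ y ≡ x
    e = ℤ-Solver.solve-∀

  -- The absolute value in `position` is exact once m ≥ -N, which follows from |m| ≤ m² ≤ N.
  offset-position : ∀ m → square m ℕ.≤ N → offset (position m) ≡ m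
  offset-position m m²≤N = ≡.trans (cong (ℤ._- + N) (nonneg m m²≤N)) (e m (+ N))
    where
    e : ∀ x y → x ℤ.+ y ℤ.- y ≡ x
    e = ℤ-Solver.solve-∀
    nonneg : ∀ m → square m ℕ.≤ N → + ℤ.∣ m ℤ.+ + N ∣ ≡ m ℤ.+ + N
    nonneg (+ m)    _  = ≡.refl
    nonneg -[1+ m ] le = ℤ.0≤i⇒+∣i∣≡i (subst (+ 0 ℤ.≤_) (≡.sym (ℤ.⊖-≥ (ℕ.≤-trans (ℕ.m≤m*n (suc m) (suc m)) le))) (ℤ.+≤+ z≤n))

  total-offsets : ∀ y → quadSum y ≡ 4 ℕ.* N → total (offsets y) ≡ + 0
  total-offsets (a , b , c , d) s = ≡.trans (e (+ a) (+ b) (+ c) (+ d) (+ N))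
    (≡.trans (cong (ℤ._- + 4 ℤ.* + N) (≡.trans (cong +_ s) (ℤ.pos-* 4 N))) (ℤ.+-inverseʳ (+ 4 ℤ.* + N)))
    where
    e : ∀ a b c d n → (a ℤ.- n) ℤ.+ ((b ℤ.- n) ℤ.+ ((c ℤ.- n) ℤ.+ (d ℤ.- n))) ≡ (a ℤ.+ (b ℤ.+ (c ℤ.+ d))) ℤ.- + 4 ℤ.* n
    e = ℤ-Solver.solve-∀

  quadSum-offsets : ∀ y → total (offsets y) ≡ + 0 → quadSum y ≡ 4 ℕ.* N
  quadSum-offsets (a , b , c , d) s = ℤ.+-injective (≡.trans (e (+ a) (+ b) (+ c) (+ d) (+ N))
    (≡.trans (cong (λ z → z ℤ.+ + 4 ℤ.* + N) s) (≡.trans (ℤ.+-identityˡ _) (≡.sym (ℤ.pos-* 4 N)))))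
    where
    e : ∀ a b c d n → (a ℤ.+ (b ℤ.+ (c ℤ.+ d))) ≡ (a ℤ.- n) ℤ.+ ((b ℤ.- n) ℤ.+ ((c ℤ.- n) ℤ.+ (d ℤ.- n))) ℤ.+ + 4 ℤ.* n
    e = ℤ-Solver.solve-∀

  -- Σ m (m + 1) = Σ m² + Σ m, and the linear part vanishes for balanced quadruples: the triangular
  -- exponents become half the norm.
  norm-offsets : ∀ y → total (offsets y) ≡ + 0 → norm (offsets y) ≡ quadWeight N y ℕ.* 2
  norm-offsets (a , b , c , d) s = ℤ.+-injective (≡.trans (+norm (offset a) (offset b) (offset c) (offset d))
    (≡.trans (≡.sym (≡.trans (cong (λ z → squares ℤ.+ z) s) (ℤ.+-identityʳ squares)))
    (≡.trans (e (offset a) (offset b) (offset c) (offset d)) (≡.sym (≡.trans (cong +_ distribute)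
      (cong₂ ℤ._+_ (+tri a N) (cong₂ ℤ._+_ (+tri b N) (cong₂ ℤ._+_ (+tri c N) (+tri d N)))))))))
    where
    squares = offset a ℤ.* offset a ℤ.+ (offset b ℤ.* offset b ℤ.+ (offset c ℤ.* offset c ℤ.+ offset d ℤ.* offset d))
    e : ∀ x y z w → x ℤ.* x ℤ.+ (y ℤ.* y ℤ.+ (z ℤ.* z ℤ.+ w ℤ.* w)) ℤ.+ (x ℤ.+ (y ℤ.+ (z ℤ.+ w)))
      ≡ x ℤ.* (x ℤ.+ + 1) ℤ.+ (y ℤ.* (y ℤ.+ + 1) ℤ.+ (z ℤ.* (z ℤ.+ + 1) ℤ.+ w ℤ.* (w ℤ.+ + 1)))
    e = ℤ-Solver.solve-∀
    distribute : quadWeight N (a , b , c , d) ℕ.* 2 ≡ tri a N ℕ.* 2 ℕ.+ (tri b N ℕ.* 2 ℕ.+ (tri c N ℕ.* 2 ℕ.+ tri d N ℕ.* 2))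
    distribute = ≡.trans (ℕ.*-distribʳ-+ 2 (tri a N) _) (cong (tri a N ℕ.* 2 ℕ.+_)
      (≡.trans (ℕ.*-distribʳ-+ 2 (tri b N) _) (cong (tri b N ℕ.* 2 ℕ.+_) (ℕ.*-distribʳ-+ 2 (tri c N) _))))

  offsets-positions : ∀ q → norm q ℕ.≤ N → offsets (positions q) ≡ q
  offsets-positions (a , b , c , d) le = cong₂ _,_ (offset-position a (below (ℕ.m≤m+n _ _)))
    (cong₂ _,_ (offset-position b (below (ℕ.m≤n⇒m≤o+n (square a) (ℕ.m≤m+n _ _))))
    (cong₂ _,_ (offset-position c (below (ℕ.m≤n⇒m≤o+n (square a) (ℕ.m≤n⇒m≤o+n (square b) (ℕ.m≤m+n _ _)))))
               (offset-position d (below (ℕ.m≤n⇒m≤o+n (square a) (ℕ.m≤n⇒m≤o+n (square b) (ℕ.m≤n+m _ (square c))))))))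
    where
    below : ∀ {x} → x ℕ.≤ norm (a , b , c , d) → x ℕ.≤ N
    below x≤ = ℕ.≤-trans x≤ le

  total-lattice : ∀ p → total (lattice p) ≡ + 0
  total-lattice (a , b , m) = e a b m
    where
    e : ∀ a b m → m ℤ.+ ((a ℤ.- m) ℤ.+ ((b ℤ.- m) ℤ.+ (m ℤ.- a ℤ.- b))) ≡ + 0
    e = ℤ-Solver.solve-∀

  coordinates-lattice : ∀ p → coordinates (lattice p) ≡ p
  coordinates-lattice (a , b , m) = cong₂ (λ a b → a , b , m) (e a m) (e b m)
    where
    e : ∀ a m → m ℤ.+ (a ℤ.- m) ≡ a
    e = ℤ-Solver.solve-∀

  lattice-coordinates : ∀ q → total q ≡ + 0 → lattice (coordinates q) ≡ q
  lattice-coordinates (m₁ , m₂ , m₃ , m₄) s = cong₂ (λ x yz → m₁ , x , yz) (e m₁ m₂) (cong₂ _,_ (e m₁ m₃)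
    (≡.trans (last m₁ m₂ m₃ m₄) (≡.trans (cong (λ z → m₄ ℤ.- z) s) (ℤ.+-identityʳ m₄))))
    where
    e : ∀ m a → m ℤ.+ a ℤ.- m ≡ a
    e = ℤ-Solver.solve-∀
    last : ∀ m₁ m₂ m₃ m₄ → m₁ ℤ.- (m₁ ℤ.+ m₂) ℤ.- (m₁ ℤ.+ m₃) ≡ m₄ ℤ.- (m₁ ℤ.+ (m₂ ℤ.+ (m₃ ℤ.+ m₄)))
    last = ℤ-Solver.solve-∀

  -- A lattice vector of norm 2i ≤ N has all entries between -N and N, so the shift by N loses none
  -- of them.
  quad-↔-lattice : ∀ i → i ℕ.* 2 ℕ.≤ N → BalancedQuad N i ↔ LatticePoint i
  quad-↔-lattice i 2i≤N = mk↔ₛ′ to from to-from from-to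
    where
    to : BalancedQuad N i → LatticePoint i
    to (y , s , w) = coordinates (offsets y) , ≡.trans (cong norm (lattice-coordinates (offsets y) (total-offsets y s)))
      (≡.trans (norm-offsets y (total-offsets y s)) (cong (ℕ._* 2) w))
    recover : ∀ p → norm (lattice p) ≡ i ℕ.* 2 → offsets (positions (lattice p)) ≡ lattice p
    recover p e = offsets-positions (lattice p) (ℕ.≤-trans (ℕ.≤-reflexive e) 2i≤N)
    from : LatticePoint i → BalancedQuad N i
    from (p , e) = y , quadSum-offsets y s
      , ℕ.*-cancelʳ-≡ _ i 2 (≡.trans (≡.sym (norm-offsets y s)) (≡.trans (cong norm (recover p e)) e))
      where
      y = positions (lattice p)
      s : total (offsets y) ≡ + 0
      s = ≡.trans (cong total (recover p e)) (total-lattice p)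
    to-from : ∀ p → to (from p) ≡ p
    to-from (p , e) = Σ-≡ (λ _ → ≡-irrelevant) (≡.trans (cong coordinates (recover p e)) (coordinates-lattice p))
    from-to : ∀ y → from (to y) ≡ y
    from-to (y@(a , b , c , d) , s , w) = Σ-≡ (λ _ (p , r) (p′ , r′) → cong₂ _,_ (≡-irrelevant p p′) (≡-irrelevant r r′))
      (≡.trans (cong positions (lattice-coordinates (offsets y) (total-offsets y s)))
        (cong₂ _,_ (position-offset a) (cong₂ _,_ (position-offset b) (cong₂ _,_ (position-offset c) (position-offset d)))))

balancedQuads : ℕ → ℕ → ℕ → ℕ → List Quad
balancedQuads m N K i = filter (λ y → quadWeight N y ℕ.≟ i) (filter (λ y → quadSum y ℕ.≟ K) (quads m))

fin-↔-balancedQuads : ∀ m N K i → K ℕ.< m → K ≡ 4 ℕ.* N → Fin (length (balancedQuads m N K i)) ↔ BalancedQuad N i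
fin-↔-balancedQuads m N K i K<m K≡4N = fin-↔-enumerated {P = P} (λ _ (p , r) (p′ , r′) → cong₂ _,_ (≡-irrelevant p p′) (≡-irrelevant r r′))
  (Unique.filter⁺ (λ y → quadWeight N y ℕ.≟ i) (Unique.filter⁺ (λ y → quadSum y ℕ.≟ K)
    (Unique.cartesianProduct⁺ U (Unique.cartesianProduct⁺ U (Unique.cartesianProduct⁺ U U)))))
  sound complete
  where
  P : Quad → Set
  P y = (quadSum y ≡ 4 ℕ.* N) × (quadWeight N y ≡ i)
  U : Unique (upTo m)
  U = Unique.upTo⁺ m
  sound : ∀ {y} → y ∈ balancedQuads m N K i → P y
  sound y∈ with y∈′ , w ← ∈-filter⁻ (λ y → quadWeight N y ℕ.≟ i) {xs = filter (λ y → quadSum y ℕ.≟ K) (quads m)} y∈ =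
    ≡.trans (proj₂ (∈-filter⁻ (λ y → quadSum y ℕ.≟ K) {xs = quads m} y∈′)) K≡4N , w
  complete : ∀ {y} → P y → y ∈ balancedQuads m N K i
  complete {a , b , c , d} (s , w) = ∈-filter⁺ (λ y → quadWeight N y ℕ.≟ i) (∈-filter⁺ (λ y → quadSum y ℕ.≟ K)
    (∈-cartesianProduct⁺ (below a (ℕ.m≤m+n a _))
    (∈-cartesianProduct⁺ (below b (ℕ.m≤n⇒m≤o+n a (ℕ.m≤m+n b _)))
    (∈-cartesianProduct⁺ (below c (ℕ.m≤n⇒m≤o+n a (ℕ.m≤n⇒m≤o+n b (ℕ.m≤m+n c d))))
                         (below d (ℕ.m≤n⇒m≤o+n a (ℕ.m≤n⇒m≤o+n b (ℕ.m≤n+m d c))))))) s≡K) w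
    where
    s≡K : quadSum (a , b , c , d) ≡ K
    s≡K = ≡.trans s (≡.sym K≡4N)
    below : ∀ k → k ℕ.≤ quadSum (a , b , c , d) → k ∈ upTo m
    below k k≤ = ∈-upTo⁺ (ℕ.≤-<-trans k≤ (subst (ℕ._< m) (≡.sym s≡K) K<m))

balancedQuads-count : ∀ m N K i → K ℕ.< m → K ≡ 4 ℕ.* N → i ℕ.* 2 ℕ.≤ N → + length (balancedQuads m N K i) ≡ A₃-theta i
balancedQuads-count m N K i K<m K≡4N 2i≤N = counts-value A₃-theta-counts i
  (↔-trans (fin-↔-balancedQuads m N K i K<m K≡4N) (↔-trans (quad-↔-lattice N i 2i≤N) (↔-sym (split-↔-lattice i))))

-- Reciprocals and the substitution q ↦ -q.

module SeriesScaling (R : Ring) (K : ℕ) where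
  open RingKit R
  open Series R K

  -- Substituting y times the variable is multiplicative; taken at y = -1 it squares Θ₃(-q).
  scaled-· : ∀ y f g n → ((λ i → y ^ i * f i) · (λ i → y ^ i * g i)) n ≈ y ^ n * (f · g) n
  scaled-· y f g zero    = solve 2 (λ a b → con 1 :* a :* (con 1 :* b) := con 1 :* (a :* b)) refl (f 0) (g 0)
  scaled-· y f g (suc n) = begin
    1# * f 0 * (y ^ suc n * g (suc n)) + ((λ i → y * y ^ i * f (suc i)) · (λ i → y ^ i * g i)) n
      ≈⟨ +-congˡ (trans (·-cong≤ n {g = λ i → y ^ i * g i} (λ i _ → *-assoc y (y ^ i) (f (suc i))) (λ _ _ → refl))
           (trans (·-scaleˡ y (λ i → y ^ i * f (suc i)) (λ i → y ^ i * g i) n) (*-congˡ (scaled-· y (f ∘ suc) g n)))) ⟩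
    1# * f 0 * (y ^ suc n * g (suc n)) + y * (y ^ n * ((f ∘ suc) · g) n)
      ≈⟨ solve 5 (λ a y p b c → con 1 :* a :* (y :* p :* b) :+ y :* (p :* c) := y :* p :* (a :* b :+ c)) refl (f 0) y (y ^ n) (g (suc n)) _ ⟩
    y ^ suc n * (f 0 * g (suc n) + ((f ∘ suc) · g) n)  ∎

sumTo-cong : ∀ n {F G : ℕ → ℤ} → (∀ i → i ℕ.≤ n → F i ≡ G i) → sumTo n F ≡ sumTo n G
sumTo-cong zero    e = e 0 z≤n
sumTo-cong (suc n) e = cong₂ ℤ._+_ (sumTo-cong n (λ i le → e i (ℕ.m≤n⇒m≤1+n le))) (e (suc n) ℕ.≤-refl)

-- The list of earlier coefficients inside invS is private to Defs; unification recovers its entries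
-- from the unfolding of invS.
invS-suc : ∀ f n → Σ[ g ∈ (ℕ → ℤ) ] invS f (suc n) ≡ ℤ.- sumTo n (λ i → f (suc i) ℤ.* g i)
invS-suc f n = _ , ≡.refl

invS-entry : ∀ f n i → i ℕ.≤ n → proj₁ (invS-suc f n) i ≡ invS f (n ℕ.∸ i)
invS-entry f n       zero    _        = ≡.refl
invS-entry f (suc n) (suc i) (s≤s le) = invS-entry f n i le

⊛-invS : ∀ f → f 0 ≡ + 1 → ∀ n → (f ⊛ invS f) n ≡ oneS n
⊛-invS f f0≡1 zero    = cong (λ z → z ℤ.* + 1) f0≡1
⊛-invS f f0≡1 (suc n) = begin
  (f ⊛ invS f) (suc n)                                                        ≡⟨ sumTo-suc n _ ⟩
  f 0 ℤ.* invS f (suc n) ℤ.+ S                                                ≡⟨ cong (λ z → z ℤ.* invS f (suc n) ℤ.+ S) f0≡1 ⟩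
  + 1 ℤ.* invS f (suc n) ℤ.+ S                                                ≡⟨ cong (ℤ._+ S) (ℤ.*-identityˡ (invS f (suc n))) ⟩
  invS f (suc n) ℤ.+ S                                                        ≡⟨ cong (ℤ._+ S) (proj₂ (invS-suc f n)) ⟩
  ℤ.- sumTo n (λ i → f (suc i) ℤ.* proj₁ (invS-suc f n) i) ℤ.+ S              ≡⟨ cong (λ z → ℤ.- z ℤ.+ S) (sumTo-cong n (λ i le → cong (f (suc i) ℤ.*_) (invS-entry f n i le))) ⟩
  ℤ.- S ℤ.+ S                                                                 ≡⟨ ℤ.+-inverseˡ S ⟩
  + 0                                                                         ∎
  where
  open ≡.≡-Reasoning
  S = sumTo n (λ i → f (suc i) ℤ.* invS f (n ℕ.∸ i))

infixr 8 _^ℤ_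
_^ℤ_ : ℤ → ℕ → ℤ
_^ℤ_ = RingKit._^_ ℤ-ring

-- Induction in steps of two, under which both the parity test and the sign repeat.
atNeg-sign : ∀ f n → atNeg f n ≡ (ℤ.- + 1) ^ℤ n ℤ.* f n
atNeg-sign f zero          = ≡.sym (ℤ.*-identityˡ (f 0))
atNeg-sign f (suc zero)    = ≡.sym (ℤ.-1*i≡-i (f 1))
atNeg-sign f (suc (suc n)) = ≡.trans (atNeg-sign (f ∘ suc ∘ suc) n) (e ((ℤ.- + 1) ^ℤ n) (f (suc (suc n))))
  where
  e : ∀ s x → s ℤ.* x ≡ ℤ.- + 1 ℤ.* (ℤ.- + 1 ℤ.* s) ℤ.* x
  e = ℤ-Solver.solve-∀

sign-atSquare : ∀ f n → (ℤ.- + 1) ^ℤ n ℤ.* atSquare f n ≡ atSquare f n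
sign-atSquare f n = ≡.trans (≡.sym (atNeg-sign (atSquare f) n)) (go n)
  where
  go : ∀ n → atNeg (atSquare f) n ≡ atSquare f n
  go n with n ℕ.% 2
  ... | zero  = ≡.refl
  ... | suc _ = ≡.refl

sign-timesQ-atSquare : ∀ f n → (ℤ.- + 1) ^ℤ n ℤ.* timesQ (atSquare f) n ≡ ℤ.- timesQ (atSquare f) n
sign-timesQ-atSquare f zero    = ≡.refl
sign-timesQ-atSquare f (suc n) = ≡.trans (e ((ℤ.- + 1) ^ℤ n) (atSquare f n)) (cong ℤ.-_ (sign-atSquare f n))
  where
  e : ∀ s x → ℤ.- + 1 ℤ.* s ℤ.* x ≡ ℤ.- (s ℤ.* x)
  e = ℤ-Solver.solve-∀

-- Under q ↦ -q in `theta3²`, the series Θ₃²(q²) is even and Θ₂²(q²) is odd. The additive form suits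
-- the later calculations, whose solver works in commutative semirings.
θ₋²+theta2sq : ∀ i → (atNeg theta3 ⊛ atNeg theta3) i ℤ.+ theta2sq-q2 i ≡ (θ² ⊛ θ²) i
θ₋²+theta2sq i = begin
  (atNeg theta3 ⊛ atNeg theta3) i ℤ.+ b i       ≡⟨ cong (ℤ._+ b i) (sign-⊛ theta3 (atNeg-sign theta3)) ⟩
  s ℤ.* (theta3 ⊛ theta3) i ℤ.+ b i             ≡⟨ cong (λ z → s ℤ.* z ℤ.+ b i) (theta3² i) ⟩
  s ℤ.* ((θ² ⊛ θ²) i ℤ.+ b i) ℤ.+ b i           ≡⟨ cong (ℤ._+ b i) (ℤ.*-distribˡ-+ s _ (b i)) ⟩
  s ℤ.* (θ² ⊛ θ²) i ℤ.+ s ℤ.* b i ℤ.+ b i       ≡⟨ cong₂ (λ x y → x ℤ.+ y ℤ.+ b i) (≡.sym (sign-⊛ θ² (λ j → ≡.sym (sign-atSquare theta3 j)))) (sign-timesQ-atSquare (thetaT ⊛ thetaT) i) ⟩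
  (θ² ⊛ θ²) i ℤ.+ ℤ.- b i ℤ.+ b i               ≡⟨ e ((θ² ⊛ θ²) i) (b i) ⟩
  (θ² ⊛ θ²) i                                   ∎
  where
  open ≡.≡-Reasoning
  b = theta2sq-q2
  s = (ℤ.- + 1) ^ℤ i
  e : ∀ x y → x ℤ.+ ℤ.- y ℤ.+ y ≡ x
  e = ℤ-Solver.solve-∀
  sign-⊛ : ∀ f {g} → (∀ j → g j ≡ (ℤ.- + 1) ^ℤ j ℤ.* f j) → (g ⊛ g) i ≡ s ℤ.* (f ⊛ f) i
  sign-⊛ f {g} g≡ = ≡.trans (⊛-· 0 g g i) (≡.trans (Series.·-cong≤ ℤ-ring 0 i (λ j _ → g≡ j) (λ j _ → g≡ j))
    (≡.trans (SeriesScaling.scaled-· ℤ-ring 0 (ℤ.- + 1) f f i) (cong (s ℤ.*_) (≡.sym (⊛-· 0 f f i)))))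

-- Comparison with the coefficients of the stated series.

module _ (n : ℕ) where
  open Series ℤ-ring n
  private
    module S = RingKit series
    module SL = ListSum series

  X^-coeff : ∀ a i → (X S.^ a) i ≡ monoS a i
  X^-coeff a i = ≡.trans (≡.sym (≡.trans (·-comm (X S.^ a) (const (+ 1)) i) (·-identityˡ (X S.^ a) i))) (X^-const a (+ 1) i)

  X-nilpotent : (X S.^ suc n) S.≈ S.0#
  X-nilpotent i i≤n = ≡.trans (X^-coeff (suc n) i) (vanish (suc n ℕ.≟ i))
    where
    vanish : (d : Dec (suc n ≡ i)) → (if does d then + 1 else + 0) ≡ + 0
    vanish (yes ≡.refl) = ⊥-elim (ℕ.<-irrefl ≡.refl i≤n)
    vanish (no _)       = ≡.refl

  open QBinomial series X using (qfac; module Nilpotent)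
  open Nilpotent n X-nilpotent using (qfac-stable)

  oneS-coeff : ∀ i → oneS i ≡ const (+ 1) i
  oneS-coeff zero    = ≡.refl
  oneS-coeff (suc i) = ≡.refl

  eulerTrunc-qfac : ∀ m i → eulerTrunc m i ≡ qfac m i
  eulerTrunc-qfac zero    i = oneS-coeff i
  eulerTrunc-qfac (suc m) i = ≡.trans (⊛-· n (eulerTrunc m) (oneS ⊖ monoS (suc m)) i)
    (·-cong≤ i (λ j _ → eulerTrunc-qfac m j) (λ j _ → cong₂ ℤ._-_ (oneS-coeff j) (≡.sym (X^-coeff (suc m) j))))

  lsum-powers-coeff : {A : Set} (w : A → ℕ) → ∀ xs i →
    SL.lsum (λ x → X S.^ w x) xs i ≡ + length (filter (λ x → w x ℕ.≟ i) xs)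
  lsum-powers-coeff w xs i = ≡.trans (lsum-coeff (λ x → X S.^ w x) xs i) (≡.trans
    (lsum-cong {xs = xs} (All.universal (λ x → X^-coeff (w x) i) xs))
    (≡.trans (lsum-if w (λ _ → + 1) i xs) (length-as-lsum (filter (λ x → w x ℕ.≟ i) xs))))
    where
    open MonomialSum ℤ-ring n
    open ListSum ℤ-ring

-- The comparison takes place in the ring truncated at i, where the factors 1 - q^m with m > i are
-- 1.
eulerTrunc-stable : ∀ n i → i ℕ.≤ n → qPoch i ≡ eulerTrunc n i
eulerTrunc-stable n i i≤n = ≡.trans (eulerTrunc-qfac i i i) (≡.trans
  (≡.sym (QBinomial.Nilpotent.qfac-stable (Series.series ℤ-ring i) (Series.X ℤ-ring i) i (X-nilpotent i) n i≤n i ℕ.≤-refl))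
  (≡.sym (eulerTrunc-qfac i n i)))

module Coefficients (n : ℕ) where
  open Series ℤ-ring n
  open QBinomial series X using (qfac)
  private module S = RingKit series

  -- The value 2n + 1 meets three demands: it exceeds every entry of a partition of n, it bounds the
  -- norms 2i ≤ 2n of the relevant lattice vectors, and it satisfies the hypothesis of
  -- `qfac*qbin*q^tri`.
  N : ℕ
  N = n ℕ.+ suc n

  n<N : n ℕ.< N
  n<N = ℕ.m≤n+m (suc n) n

  gfpSeries : PS
  gfpSeries i = + length (gfps N i)

  open FrobeniusSeries series X n N (X-nilpotent n) ℕ.≤-refl using (frobenius-identity)

  -- In degree i both sums of powers of q in `frobenius-identity` become cardinalities, and the one
  -- over quadruples is a lattice count because 2i ≤ N.
  qfac⁴-gfpSeries : qfac n S.⁴ · gfpSeries S.≈ A₃-theta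
  qfac⁴-gfpSeries = S.trans
    (S.*-congˡ {qfac n S.⁴} (λ i _ → ≡.sym (lsum-powers-coeff n rowWeight (filter (λ r → charge N r ℕ.≟ length (palette N)) (allRows N)) i)))
    (S.trans frobenius-identity (λ i i≤n → ≡.trans
      (lsum-powers-coeff n (quadWeight N) (filter (λ y → quadSum y ℕ.≟ length (palette N)) (quads (suc (length (palette N))))) i)
      (balancedQuads-count (suc (length (palette N))) N (length (palette N)) i ℕ.≤-refl (length-palette N) (2i≤N i≤n))))
    where
    2i≤N : ∀ {i} → i ℕ.≤ n → i ℕ.* 2 ℕ.≤ N
    2i≤N {i} i≤n = ℕ.≤-trans (ℕ.≤-reflexive (≡.trans (ℕ.*-comm i 2) (cong (i ℕ.+_) (ℕ.+-identityʳ i))))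
      (ℕ.+-mono-≤ i≤n (ℕ.m≤n⇒m≤1+n i≤n))

  ⊛-≈ : ∀ {f f′ g g′} → f S.≈ f′ → g S.≈ g′ → (f ⊛ g) S.≈ f′ · g′
  ⊛-≈ {f} {f′} {g} {g′} e e′ = S.trans {f ⊛ g} {f · g} (λ i _ → ⊛-· n f g i) (S.*-cong {f} {f′} {g} {g′} e e′)

  oneS-≈ : oneS S.≈ S.1#
  oneS-≈ i _ = oneS-coeff n i

  b : PS
  b = theta2sq-q2

  qPoch-≈ : qPoch S.≈ qfac n
  qPoch-≈ i i≤n = ≡.trans (eulerTrunc-stable n i i≤n) (eulerTrunc-qfac n n i)

  powS-1 : ∀ {f g} → f S.≈ g → powS f 1 S.≈ g
  powS-1 {f} {g} e = S.trans {powS f 1} {g · S.1#} (⊛-≈ e oneS-≈) (S.*-identityʳ g)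

  powS-suc : ∀ m {f g h} → f S.≈ g → powS f m S.≈ h → powS f (suc m) S.≈ g · h
  powS-suc m e e′ = ⊛-≈ e e′

  powS-4 : ∀ {f g} → f S.≈ g → powS f 4 S.≈ g S.⁴
  powS-4 {f} e = powS-suc 3 {f} e (powS-suc 2 {f} e (powS-suc 1 {f} e (powS-1 e)))

  Q⁴ : PS
  Q⁴ = powS qPoch 4

  Q⁴-gfpSeries : Q⁴ · gfpSeries S.≈ A₃-theta
  Q⁴-gfpSeries = S.trans {Q⁴ · gfpSeries} {qfac n S.⁴ · gfpSeries} (S.*-congʳ {gfpSeries} {Q⁴} {qfac n S.⁴} (powS-4 qPoch-≈)) qfac⁴-gfpSeries

  invS-≈ : ∀ f → f 0 ≡ + 1 → f · invS f S.≈ S.1#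
  invS-≈ f f0 = S.trans {f · invS f} {f ⊛ invS f} (λ i _ → ≡.sym (⊛-· n f (invS f) i))
    (S.trans {f ⊛ invS f} {oneS} (λ i _ → ⊛-invS f f0 i) oneS-≈)

  divide : ∀ f {g h} → f 0 ≡ + 1 → f · g S.≈ h → g S.≈ invS f · h
  divide f {g} {h} f0 e = S.trans {g} {S.1# · g} (S.sym (S.*-identityˡ g))
    (S.trans {S.1# · g} {f · invS f · g} (S.*-congʳ {g} (S.sym (invS-≈ f f0)))
    (S.trans {f · invS f · g} {invS f · (f · g)}
      (S.solve 3 (λ f u g → f S.:* u S.:* g S.:= u S.:* (f S.:* g)) S.refl f (invS f) g)
      (S.*-congˡ {invS f} e)))

  A : PS
  A = θ² · (θ² · θ²) S.+ (θ² · b S.+ (θ² · b S.+ θ² · b))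

  A₃-theta-≈ : A₃-theta S.≈ A
  A₃-theta-≈ = S.+-cong (⊛-≈ (S.refl {θ²}) (⊛-≈ (S.refl {θ²}) (S.refl {θ²}))) (S.+-cong θb (S.+-cong θb θb))
    where
    θb : (θ² ⊛ b) S.≈ θ² · b
    θb = ⊛-≈ (S.refl {θ²}) (S.refl {b})

  first-form : gfpSeries S.≈ (invS Q⁴ ⊛ (powS θ² 3 ⊕ scaleS (+ 3) (θ² ⊛ b)))
  first-form = S.trans (divide Q⁴ ≡.refl (S.trans {Q⁴ · gfpSeries} Q⁴-gfpSeries A₃-theta-≈))
    (S.sym (⊛-≈ (S.refl {invS Q⁴}) (S.+-cong
      (powS-suc 2 {θ²} (S.refl {θ²}) (powS-suc 1 {θ²} (S.refl {θ²}) (powS-1 (S.refl {θ²}))))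
      (S.trans triple (S.+-cong θb (S.+-cong θb θb))))))
    where
    θb : (θ² ⊛ b) S.≈ θ² · b
    θb = ⊛-≈ (S.refl {θ²}) (S.refl {b})
    triple : scaleS (+ 3) (θ² ⊛ b) S.≈ ((θ² ⊛ b) S.+ ((θ² ⊛ b) S.+ (θ² ⊛ b)))
    triple i _ = e ((θ² ⊛ b) i)
      where
      e : ∀ x → + 3 ℤ.* x ≡ x ℤ.+ (x ℤ.+ x)
      e = ℤ-Solver.solve-∀

  θ₋ : PS
  θ₋ = atNeg theta3

  theta3²-≈ : theta3 · theta3 S.≈ (θ² · θ² S.+ b)
  theta3²-≈ i _ = ≡.trans (≡.sym (⊛-· n theta3 theta3 i)) (≡.trans (theta3² i) (cong (ℤ._+ b i) (⊛-· n θ² θ² i)))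

  θ₋²-≈ : θ² · θ² S.≈ (θ₋ · θ₋ S.+ b)
  θ₋²-≈ i _ = ≡.trans (≡.sym (⊛-· n θ² θ² i)) (≡.trans (≡.sym (θ₋²+theta2sq i)) (cong (ℤ._+ b i) (⊛-· n θ₋ θ₋ i)))

  -- With B = Θ₂²(q²) and M = Θ₃²(−q), both sides are M² + 5 M B + 4 B².
  θ²*A : θ² · A S.≈ (theta3 S.⁴ S.+ θ₋ · θ₋ · b)
  θ²*A = S.begin
    θ² · A
      S.≈⟨ S.solve 2 (λ t b → t S.:* (t S.:* (t S.:* t) S.:+ (t S.:* b S.:+ (t S.:* b S.:+ t S.:* b)))
            S.:= t S.:* t S.:* (t S.:* t S.:+ (b S.:+ (b S.:+ b)))) S.refl θ² b ⟩
    θ² · θ² · (θ² · θ² S.+ (b S.+ (b S.+ b)))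
      S.≈⟨ S.*-cong {θ² · θ²} {θ₋ · θ₋ S.+ b} θ₋²-≈ (S.+-congʳ {b S.+ (b S.+ b)} θ₋²-≈) ⟩
    (θ₋ · θ₋ S.+ b) · (θ₋ · θ₋ S.+ b S.+ (b S.+ (b S.+ b)))
      S.≈⟨ S.solve 2 (λ m b → (m S.:+ b) S.:* (m S.:+ b S.:+ (b S.:+ (b S.:+ b)))
            S.:= (m S.:+ b S.:+ b) S.:* (m S.:+ b S.:+ b) S.:+ m S.:* b) S.refl (θ₋ · θ₋) b ⟩
    ((θ₋ · θ₋ S.+ b S.+ b) · (θ₋ · θ₋ S.+ b S.+ b) S.+ θ₋ · θ₋ · b)
      S.≈⟨ S.+-congʳ {θ₋ · θ₋ · b} (S.*-cong square-≈ square-≈) ⟨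
    (theta3 · theta3 · (theta3 · theta3) S.+ θ₋ · θ₋ · b)
      S.≈⟨ S.+-congʳ {θ₋ · θ₋ · b} (S.*-assoc theta3 theta3 (theta3 · theta3)) ⟩
    (theta3 S.⁴ S.+ θ₋ · θ₋ · b)  S.∎
    where
    square-≈ : theta3 · theta3 S.≈ (θ₋ · θ₋ S.+ b S.+ b)
    square-≈ = S.trans theta3²-≈ (S.+-congʳ {b} θ₋²-≈)

  -- Multiplication by (q;q)_∞⁴ Θ₃(q²), a series with constant term 1, reduces the claim to `θ²*A`.
  second-form : gfpSeries S.≈ ((invS (Q⁴ ⊛ θ²) ⊛ powS theta3 4) ⊕ (invS (Q⁴ ⊛ θ²) ⊛ (powS θ₋ 2 ⊛ b)))
  second-form = S.trans (divide (Q⁴ ⊛ θ²) ≡.refl product)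
    (S.trans {u · (theta3 S.⁴ S.+ θ₋ · θ₋ · b)} {u · theta3 S.⁴ S.+ u · (θ₋ · θ₋ · b)} (S.distribˡ u (theta3 S.⁴) (θ₋ · θ₋ · b))
      (S.sym (S.+-cong (⊛-≈ (S.refl {u}) (powS-4 (S.refl {theta3})))
        (⊛-≈ (S.refl {u}) (⊛-≈ (powS-suc 1 {θ₋} (S.refl {θ₋}) (powS-1 (S.refl {θ₋}))) (S.refl {b}))))))
    where
    u = invS (Q⁴ ⊛ θ²)
    product : (Q⁴ ⊛ θ²) · gfpSeries S.≈ (theta3 S.⁴ S.+ θ₋ · θ₋ · b)
    product = S.begin
      (Q⁴ ⊛ θ²) · gfpSeries   S.≈⟨ S.*-congʳ {gfpSeries} {Q⁴ ⊛ θ²} {Q⁴ · θ²} (λ i _ → ⊛-· n Q⁴ θ² i) ⟩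
      Q⁴ · θ² · gfpSeries     S.≈⟨ S.solve 3 (λ q t g → q S.:* t S.:* g S.:= t S.:* (q S.:* g)) S.refl Q⁴ θ² gfpSeries ⟩
      θ² · (Q⁴ · gfpSeries)   S.≈⟨ S.*-congˡ {θ²} (S.trans {Q⁴ · gfpSeries} Q⁴-gfpSeries A₃-theta-≈) ⟩
      θ² · A                  S.≈⟨ θ²*A ⟩
      (theta3 S.⁴ S.+ θ₋ · θ₋ · b)  S.∎

theorem6p1 : (n : ℕ) → Σ[ m ∈ ℕ ] ((Fin m ↔ GFP 4 n)
    × (+ m ≡ (invS (powS qPoch 4) ⊛ (powS (atSquare theta3) 3
    ⊕ scaleS (+ 3) (atSquare theta3 ⊛ theta2sq-q2))) n)
    × (+ m ≡ ((invS (powS qPoch 4 ⊛ atSquare theta3) ⊛ powS theta3 4)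
    ⊕ (invS (powS qPoch 4 ⊛ atSquare theta3)
    ⊛ (powS (atNeg theta3) 2 ⊛ theta2sq-q2))) n))
-- Both forms hold in every degree up to n and are read off at the top degree.
theorem6p1 n = length (gfps N n) , fin-↔-GFP N n n<N , first-form n ℕ.≤-refl , second-form n ℕ.≤-refl
  where open Coefficients n
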